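{- Let $n$ be a positive integer with $n\equiv 0 \pmod{10}$ and $n\neq 10,160,190$. Then there exists a configuration $(1,5)$ $GDD\left(n,2,6;2n,n-1\right)$.
   Context: A $GDD(n,2,6;\lambda_1,\lambda_2)$ is a finite collection (repetitions allowed) of $6$-element subsets, called blocks, of a $2n$-element set $X$ partitioned into two groups of size $n$, such that every point lies in the same number $r$ of blocks, any two distinct points of the same group lie together in exactly $\lambda_1$ blocks, and any two points from different groups lie together in exactly $\lambda_2$ blocks. It has configuration $(1,5)$ if every block has exactly $1$ point in one of the two groups and $5$ points in the other (which group contains the single point may depend on the block). -}

module Defs where

open import Data.Nat using (ℕ; _*_)
open import Data.Fin using (Fin; zero; suc; _≟_)
open import Data.Fin.Subset using (Subset; _∩_; ∣_∣)
open import Data.Fin.Subset.Properties using (_∈?_)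
open import Data.List using (List; length; filter)
open import Data.List.Relation.Unary.All using (All)
open import Data.Product using (_×_)
open import Data.Sum using (_⊎_)
open import Data.Vec using (tabulate)
open import Relation.Nullary using (does)
open import Relation.Nullary.Decidable using (_×-dec_)
open import Relation.Binary.PropositionalEquality using (_≡_; _≢_)

-- A collection of blocks is a list, so repeated blocks count with multiplicity.
replication : ∀ {v} → List (Subset v) → Fin v → ℕ
replication Bs x = length (filter (λ B → x ∈? B) Bs)

index : ∀ {v} → List (Subset v) → Fin v → Fin v → ℕ
index Bs x y = length (filter (λ B → (x ∈? B) ×-dec (y ∈? B)) Bs)

-- GDD(n, m, k; λ₁, λ₂).  The point set is Fin (m * n); the partition into m
-- groups is given by the map sending each point to the label of its group.
record GDD (n m k λ₁ λ₂ : ℕ) : Set where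
  field
    groupOf : Fin (m * n) → Fin m
    blocks  : List (Subset (m * n))

  group : Fin m → Subset (m * n)
  group i = tabulate (λ x → does (groupOf x ≟ i))

  field
    groupSize : ∀ i → ∣ group i ∣ ≡ n
    blockSize : All (λ B → ∣ B ∣ ≡ k) blocks
    r         : ℕ
    regular   : ∀ x → replication blocks x ≡ r
    sameGroup : ∀ x y → x ≢ y → groupOf x ≡ groupOf y → index blocks x y ≡ λ₁
    diffGroup : ∀ x y → groupOf x ≢ groupOf y → index blocks x y ≡ λ₂

-- Which of the two groups contributes s points may vary from block to block.
HasConfiguration : ∀ {n k λ₁ λ₂} → ℕ → ℕ → GDD n 2 k λ₁ λ₂ → Set
HasConfiguration s t D = All split blocks
  where
  open GDD D
  split : Subset _ → Set
  split B = (∣ B ∩ group zero ∣ ≡ s × ∣ B ∩ group (suc zero) ∣ ≡ t)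
          ⊎ (∣ B ∩ group zero ∣ ≡ t × ∣ B ∩ group (suc zero) ∣ ≡ s)

{-# OPTIONS --safe #-}
-- Let n = c g. The points are the pairs in Z_2c × K, where the parity of the colour in Z_2c tells the two groups
-- apart and K is an idempotent quasigroup of order g. Each (x , y , v) ∈ K³ yields seven columns
-- x, y, x∙y | x∙v, y∙v, (x∙y)∙v | v. Over all of K³, two distinct positions take every pair of values g times;
-- over the triples with x = y, positions of different classes take every pair of values once, and positions of the
-- same class take only equal values, each g times. A pattern is a choice of six coloured positions, translated
-- through Z_2c. Generic patterns yield the blocks with x ≠ y, that is, all of them minus the diagonal x = y, and
-- degenerate patterns yield blocks with x = y. So the number of blocks on two points is 2cg or cg according to the
-- parity of their colour difference, less the diagonal of the generic patterns, plus the degenerate patterns.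
-- These two corrections cancel for even differences and leave −1 for odd ones when the patterns satisfy finitely
-- many conditions that do not involve g. Two such systems of patterns, for c = 10 and c = 20, were found by
-- computer search. The first gives all n = 10 g with g ≠ 2 (there is no idempotent quasigroup of order 2), and the
-- second with g = 1 gives n = 20.
module Submission where

import Algebra.Properties.CommutativeSemigroup as CommutativeSemigroup
open import Data.Bool using (Bool; true; false; if_then_else_; _∧_)
open import Data.Nat using (>-nonZero⁻¹; ℕ; zero; suc; _+_; _*_; _∸_; _<_; NonZero; s≤s) renaming (_≟_ to _≟ℕ_)
open import Data.Nat.Properties hiding (_≟_; suc-injective)
open import Data.Nat.DivMod
open import Data.Nat.Divisibility using (m∣m*n)
open import Data.Nat.ListAction using (sum)
open import Data.Nat.Solver using (module +-*-Solver)
open import Data.Nat.ListAction.Properties using (sum-++)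
open import Data.Fin using (#_; Fin; zero; suc; toℕ; punchOut; _≟_; cast; combine; remQuot)
open import Data.Fin.Properties using (toℕ-injective; toℕ-fromℕ<; toℕ<n; any?; all?; punchOut-injective; injective⇒≤; suc-injective; remQuot-combine; combine-remQuot; cast-involutive)
open import Data.Fin.Subset using (Subset; ∣_∣; _∩_)
import Data.Fin.Subset.Properties as Subset
open import Data.List using (zip; List; []; _∷_; _++_; map; length; filter; allFin; cartesianProduct)
open import Data.List.Properties using (length-map; map-++; map-∘; map-tabulate; length-tabulate)
open import Data.List.Relation.Unary.All using (All; []; _∷_)
import Data.List.Relation.Unary.All as All
import Data.List.Relation.Unary.All.Properties as All
open import Data.List.Relation.Unary.AllPairs using (AllPairs; []; _∷_; allPairs?)
import Data.List.Relation.Unary.AllPairs as AllPairs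
import Data.List.Relation.Unary.AllPairs.Properties as AllPairs
open import Data.List.Relation.Unary.Any using (here; there)
import Data.List.Membership.DecPropositional as DecMembership
open import Data.Product using (Σ; ∃; _×_; _,_; proj₁; proj₂; uncurry)
open import Data.Product.Properties using (≡-dec)
open import Data.Sum using (_⊎_; inj₁; inj₂)
import Data.Vec as Vec
open import Function using (_∘_; id; Injective)
open import Relation.Nullary using (Dec; does; yes; no; ¬_; ¬?; contradiction)
open import Relation.Nullary.Decidable using (_×-dec_; _⊎-dec_; _→-dec_; from-yes)
open import Relation.Unary using (Decidable)
open import Relation.Binary.Definitions using (DecidableEquality)
open import Relation.Binary.PropositionalEquality using (_≡_; _≢_; _≗_; refl; sym; trans; cong; cong₂; subst; subst₂; setoid; module ≡-Reasoning)
open import Defs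

open ≡-Reasoning
open CommutativeSemigroup +-commutativeSemigroup using () renaming (interchange to +-interchange)
open CommutativeSemigroup *-commutativeSemigroup using () renaming (interchange to *-interchange)

private variable
  A B P Q : Set

-- Sums over lists

∑ : List A → (A → ℕ) → ℕ
∑ xs f = sum (map f xs)

syntax ∑ xs (λ x → e) = ∑[ x ∈ xs ] e
infix 7.5 ∑

∑-cong : ∀ (xs : List A) {f g : A → ℕ} → f ≗ g → ∑ xs f ≡ ∑ xs g
∑-cong []       f≗g = refl
∑-cong (x ∷ xs) f≗g = cong₂ _+_ (f≗g x) (∑-cong xs f≗g)

∑-congᴬ : ∀ {xs : List A} {f g : A → ℕ} → All (λ x → f x ≡ g x) xs → ∑ xs f ≡ ∑ xs g
∑-congᴬ []         = refl
∑-congᴬ (eq ∷ eqs) = cong₂ _+_ eq (∑-congᴬ eqs)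

∑-++ : ∀ (xs ys : List A) f → ∑ (xs ++ ys) f ≡ ∑ xs f + ∑ ys f
∑-++ xs ys f = trans (cong sum (map-++ f xs ys)) (sum-++ (map f xs) (map f ys))

∑-map : ∀ (h : A → B) xs f → ∑ (map h xs) f ≡ ∑ xs (f ∘ h)
∑-map h xs f = cong sum (sym (map-∘ {g = f} {f = h} xs))

∑-+ : ∀ (xs : List A) f g → ∑[ x ∈ xs ] (f x + g x) ≡ ∑ xs f + ∑ xs g
∑-+ []       f g = refl
∑-+ (x ∷ xs) f g = trans (cong (f x + g x +_) (∑-+ xs f g)) (+-interchange (f x) (g x) (∑ xs f) (∑ xs g))

∑-*ˡ : ∀ k (xs : List A) f → ∑[ x ∈ xs ] (k * f x) ≡ k * ∑ xs f
∑-*ˡ k []       f = sym (*-zeroʳ k)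
∑-*ˡ k (x ∷ xs) f = trans (cong (k * f x +_) (∑-*ˡ k xs f)) (sym (*-distribˡ-+ k (f x) (∑ xs f)))

∑-*ʳ : ∀ k (xs : List A) f → ∑[ x ∈ xs ] (f x * k) ≡ ∑ xs f * k
∑-*ʳ k xs f = trans (∑-cong xs λ x → *-comm (f x) k) (trans (∑-*ˡ k xs f) (*-comm k _))

∑-const : ∀ k (xs : List A) → ∑[ _ ∈ xs ] k ≡ length xs * k
∑-const k []       = refl
∑-const k (x ∷ xs) = cong (k +_) (∑-const k xs)

∑-swap : ∀ (xs : List A) (ys : List B) (f : A → B → ℕ) → ∑[ x ∈ xs ] ∑[ y ∈ ys ] f x y ≡ ∑[ y ∈ ys ] ∑[ x ∈ xs ] f x y
∑-swap []       ys f = sym (trans (∑-const 0 ys) (*-zeroʳ (length ys)))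
∑-swap (x ∷ xs) ys f = trans (cong (∑ ys (f x) +_) (∑-swap xs ys f)) (sym (∑-+ ys (f x) λ y → ∑[ x ∈ xs ] f x y))

∑-× : ∀ (xs : List A) (ys : List B) f → ∑ (cartesianProduct xs ys) f ≡ ∑[ x ∈ xs ] ∑[ y ∈ ys ] f (x , y)
∑-× []       ys f = refl
∑-× (x ∷ xs) ys f = trans (∑-++ (map (x ,_) ys) _ f) (cong₂ _+_ (∑-map (x ,_) ys f) (∑-× xs ys f))

∑-* : ∀ (xs : List A) (ys : List B) f g → ∑ xs f * ∑ ys g ≡ ∑[ x ∈ xs ] ∑[ y ∈ ys ] (f x * g y)
∑-* xs ys f g = trans (sym (∑-*ʳ (∑ ys g) xs f)) (∑-cong xs λ x → sym (∑-*ˡ (f x) ys g))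

-- Indicators of decidable propositions.

𝟙 : Dec P → ℕ
𝟙 p = if does p then 1 else 0

𝟙-yes : (p : Dec P) → P → 𝟙 p ≡ 1
𝟙-yes (yes _) _ = refl
𝟙-yes (no ¬p) p = contradiction p ¬p

𝟙-no : (p : Dec P) → ¬ P → 𝟙 p ≡ 0
𝟙-no (yes p) ¬p = contradiction p ¬p
𝟙-no (no _)  _  = refl

𝟙-⇔ : (p : Dec P) (q : Dec Q) → (P → Q) → (Q → P) → 𝟙 p ≡ 𝟙 q
𝟙-⇔ (yes p) q f g = sym (𝟙-yes q (f p))
𝟙-⇔ (no ¬p) q f g = sym (𝟙-no q (¬p ∘ g))

𝟙-× : (p : Dec P) (q : Dec Q) → 𝟙 (p ×-dec q) ≡ 𝟙 p * 𝟙 q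
𝟙-× (yes _) (yes _) = refl
𝟙-× (yes _) (no _)  = refl
𝟙-× (no _)  _       = refl

length-filter≡∑ : ∀ {P : A → Set} (P? : Decidable P) xs → length (filter P? xs) ≡ ∑[ x ∈ xs ] 𝟙 (P? x)
length-filter≡∑ P? []       = refl
length-filter≡∑ P? (x ∷ xs) with P? x
... | yes _ = cong suc (length-filter≡∑ P? xs)
... | no _  = length-filter≡∑ P? xs

∑-filter : ∀ {P : A → Set} (P? : Decidable P) xs f → ∑ (filter P? xs) f ≡ ∑[ x ∈ xs ] (𝟙 (P? x) * f x)
∑-filter P? []       f = refl
∑-filter P? (x ∷ xs) f with P? x
... | yes _ = cong₂ _+_ (sym (*-identityˡ (f x))) (∑-filter P? xs f)
... | no _  = ∑-filter P? xs f

∑-partition : ∀ {P : A → Set} (P? : Decidable P) xs f →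
  ∑ (filter (¬? ∘ P?) xs) f + ∑ (filter P? xs) f ≡ ∑ xs f
∑-partition P? []       f = refl
∑-partition P? (x ∷ xs) f with P? x
... | no _  = trans (+-assoc (f x) _ _) (cong (f x +_) (∑-partition P? xs f))
... | yes _ = begin
  N + (f x + Y) ≡⟨ +-assoc N (f x) Y ⟨
  N + f x + Y   ≡⟨ cong (_+ Y) (+-comm N (f x)) ⟩
  f x + N + Y   ≡⟨ +-assoc (f x) N Y ⟩
  f x + (N + Y) ≡⟨ cong (f x +_) (∑-partition P? xs f) ⟩
  f x + ∑ xs f  ∎
  where
  N = ∑ (filter (¬? ∘ P?) xs) f
  Y = ∑ (filter P? xs) f

-- Sums over `Fin n` and the Kronecker delta.

∑-allFin-suc : ∀ n f → ∑ (allFin (suc n)) f ≡ f zero + ∑ (allFin n) (f ∘ suc)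
∑-allFin-suc n f = cong (f zero +_) (cong sum (trans (map-tabulate suc f) (sym (map-tabulate id (f ∘ suc)))))

δ : ∀ {n} → Fin n → Fin n → ℕ
δ i j = 𝟙 (i ≟ j)

δ-sym : ∀ {n} (i j : Fin n) → δ i j ≡ δ j i
δ-sym i j = 𝟙-⇔ (i ≟ j) (j ≟ i) sym sym

δ-refl : ∀ {n} (i : Fin n) → δ i i ≡ 1
δ-refl i = 𝟙-yes (i ≟ i) refl

δ-suc : ∀ {n} (i j : Fin n) → δ (suc i) (suc j) ≡ δ i j
δ-suc i j = 𝟙-⇔ (suc i ≟ suc j) (i ≟ j) suc-injective (cong suc)

-- Sifting: a sum over a parameter that an equation determines collapses to one term. The counts of
-- points and pairs below rest on this.
∑-δ : ∀ {n} (a : Fin n) (h : Fin n → ℕ) → ∑[ i ∈ allFin n ] (δ i a * h i) ≡ h a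
∑-δ {suc n} zero h = begin
  ∑[ i ∈ allFin (suc n) ] (δ i zero * h i)                   ≡⟨ ∑-allFin-suc n (λ i → δ i zero * h i) ⟩
  1 * h zero + ∑[ i ∈ allFin n ] 0                           ≡⟨ cong₂ _+_ (*-identityˡ (h zero)) (trans (∑-const 0 (allFin n)) (*-zeroʳ (length (allFin n)))) ⟩
  h zero + 0                                                 ≡⟨ +-identityʳ (h zero) ⟩
  h zero                                                     ∎
∑-δ {suc n} (suc a) h = begin
  ∑[ i ∈ allFin (suc n) ] (δ i (suc a) * h i)                ≡⟨ ∑-allFin-suc n (λ i → δ i (suc a) * h i) ⟩
  ∑[ i ∈ allFin n ] (δ (suc i) (suc a) * h (suc i))          ≡⟨ ∑-cong (allFin n) (λ i → cong (_* h (suc i)) (δ-suc i a)) ⟩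
  ∑[ i ∈ allFin n ] (δ i a * h (suc i))                      ≡⟨ ∑-δ a (h ∘ suc) ⟩
  h (suc a)                                                  ∎

∑-δ₁ : ∀ {n} (a : Fin n) → ∑[ i ∈ allFin n ] δ i a ≡ 1
∑-δ₁ {n} a = trans (∑-cong (allFin n) λ i → sym (*-identityʳ (δ i a))) (∑-δ a λ _ → 1)

∑-allFin-const : ∀ k n → ∑[ _ ∈ allFin n ] k ≡ n * k
∑-allFin-const k n = trans (∑-const k (allFin n)) (cong (_* k) (length-tabulate {n = n} id))

-- Congruences modulo n.

module Modular (n : ℕ) .{{_ : NonZero n}} where

  infix 4 _≈_
  -- A record rather than the bare equation of residues: `_%_` is not injective, so `a` and `b`
  -- could not be inferred from that equation.
  record _≈_ (a b : ℕ) : Set where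
    constructor residues
    field residue-≡ : a % n ≡ b % n

  open _≈_ public

  ≈-reflexive : ∀ {a b} → a ≡ b → a ≈ b
  ≈-reflexive = residues ∘ cong (_% n)

  ≈-refl : ∀ {a} → a ≈ a
  ≈-refl = residues refl

  ≈-sym : ∀ {a b} → a ≈ b → b ≈ a
  ≈-sym (residues p) = residues (sym p)

  ≈-trans : ∀ {a b c} → a ≈ b → b ≈ c → a ≈ c
  ≈-trans (residues p) (residues q) = residues (trans p q)

  +-≈ : ∀ {a b c d} → a ≈ b → c ≈ d → a + c ≈ b + d
  +-≈ {a} {b} {c} {d} (residues p) (residues q) = residues
    (trans (%-distribˡ-+ a c n) (trans (cong₂ (λ x y → (x + y) % n) p q) (sym (%-distribˡ-+ b d n))))

  *-≈ : ∀ {a b c d} → a ≈ b → c ≈ d → a * c ≈ b * d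
  *-≈ {a} {b} {c} {d} (residues p) (residues q) = residues
    (trans (%-distribˡ-* a c n) (trans (cong₂ (λ x y → (x * y) % n) p q) (sym (%-distribˡ-* b d n))))

  %-≈ : ∀ a → a % n ≈ a
  %-≈ a = residues (m%n%n≡m%n a n)

  -- The additive inverse modulo `n`. The subtraction is exact, since a residue is at most `n`; a
  -- multiple of `n` is sent to `n` instead of 0, which has the same residue.
  neg : ℕ → ℕ
  neg a = n ∸ a % n

  +-neg : ∀ a → a + neg a ≈ 0
  +-neg a = ≈-trans (+-≈ (≈-sym (%-≈ a)) ≈-refl)
    (≈-trans (≈-reflexive (m+[n∸m]≡n (m%n≤n a n)))
             (residues (trans (n%n≡0 n) (sym (m*n%n≡0 0 n)))))

  +-neg-+ : ∀ a b → a + (neg a + b) ≈ b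
  +-neg-+ a b = ≈-trans (≈-reflexive (sym (+-assoc a (neg a) b))) (+-≈ (+-neg a) ≈-refl)

  neg-+-+ : ∀ a b → neg a + (a + b) ≈ b
  neg-+-+ a b = ≈-trans
    (≈-reflexive (trans (sym (+-assoc (neg a) a b)) (cong (_+ b) (+-comm (neg a) a))))
    (+-≈ (+-neg a) ≈-refl)

  +-cancelˡ-≈ : ∀ a {b c} → a + b ≈ a + c → b ≈ c
  +-cancelˡ-≈ a {b} {c} p = ≈-trans (≈-sym (neg-+-+ a b)) (≈-trans (+-≈ {neg a} ≈-refl p) (neg-+-+ a c))

  toℕ-≈-injective : ∀ {i j : Fin n} → toℕ i ≈ toℕ j → i ≡ j
  toℕ-≈-injective {i} {j} (residues p) =
    toℕ-injective (trans (sym (m<n⇒m%n≡m (toℕ<n i))) (trans p (m<n⇒m%n≡m (toℕ<n j))))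

  toℕ-mod : ∀ a → toℕ (a mod n) ≈ a
  toℕ-mod a = ≈-trans (≈-reflexive (toℕ-fromℕ< (m%n<n a n))) (%-≈ a)

  mod-≈ : ∀ {a b} → a ≈ b → a mod n ≡ b mod n
  mod-≈ {a} {b} p = toℕ-≈-injective (≈-trans (toℕ-mod a) (≈-trans p (≈-sym (toℕ-mod b))))

  mod-≈⁻¹ : ∀ {a b} → a mod n ≡ b mod n → a ≈ b
  mod-≈⁻¹ {a} {b} p = ≈-trans (≈-sym (toℕ-mod a)) (≈-trans (≈-reflexive (cong toℕ p)) (toℕ-mod b))

-- Pigeonhole: if `w` were missed, punching it out of the codomain would inject `suc n` elements
-- into `n`.
Fin-injective⇒surjective : ∀ {n} {f : Fin n → Fin n} → Injective _≡_ _≡_ f → ∀ w → ∃ λ y → f y ≡ w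
Fin-injective⇒surjective {suc n} {f} inj w with any? (λ y → f y ≟ w)
... | yes hit = hit
... | no miss = contradiction (injective⇒≤ punched-injective) 1+n≰n
  where
  w≢f : ∀ y → w ≢ f y
  w≢f y w≡fy = miss (y , sym w≡fy)
  punched-injective : Injective _≡_ _≡_ (λ y → punchOut (w≢f y))
  punched-injective = inj ∘ punchOut-injective (w≢f _) (w≢f _)

-- Idempotent quasigroups

-- Cancellation suffices as an axiom: by finiteness all left and right multiplications are
-- bijections, which gives both divisions.
record IdempotentQuasigroup (g : ℕ) : Set where
  infixl 7 _∙_
  field
    _∙_     : Fin g → Fin g → Fin g
    idem    : ∀ x → x ∙ x ≡ x
    cancelˡ : ∀ x {y z} → x ∙ y ≡ x ∙ z → y ≡ z
    cancelʳ : ∀ x {y z} → y ∙ x ≡ z ∙ x → y ≡ z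

  infixr 7 _\\_
  infixl 7 _//_
  _\\_ _//_ : Fin g → Fin g → Fin g
  x \\ w = proj₁ (Fin-injective⇒surjective (cancelˡ x) w)
  w // x = proj₁ (Fin-injective⇒surjective (cancelʳ x) w)

  ∙-\\ : ∀ x w → x ∙ (x \\ w) ≡ w
  ∙-\\ x w = proj₂ (Fin-injective⇒surjective (cancelˡ x) w)

  //-∙ : ∀ w x → (w // x) ∙ x ≡ w
  //-∙ w x = proj₂ (Fin-injective⇒surjective (cancelʳ x) w)

  -- Solves the equation for one factor, the form in which `∑-δ₁` can sum over it.
  δ-\\ : ∀ x y w → δ (x ∙ y) w ≡ δ y (x \\ w)
  δ-\\ x y w = 𝟙-⇔ (x ∙ y ≟ w) (y ≟ x \\ w)
    (λ p → cancelˡ x (trans p (sym (∙-\\ x w))))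
    (λ p → trans (cong (x ∙_) p) (∙-\\ x w))

  δ-// : ∀ x y w → δ (x ∙ y) w ≡ δ x (w // y)
  δ-// x y w = 𝟙-⇔ (x ∙ y ≟ w) (x ≟ w // y)
    (λ p → cancelʳ y (trans p (sym (//-∙ w y))))
    (λ p → trans (cong (_∙ y) p) (//-∙ w y))

module Midpoint (k : ℕ) where

  N : ℕ
  N = suc (k + k)

  open Modular N

  -- Since 2(k + 1) = N + 1, `suc k` is one half modulo N, and this is the midpoint (x + y)/2 in
  -- Z_N.
  mid : Fin N → Fin N → Fin N
  mid x y = (suc k * (toℕ x + toℕ y)) mod N

  half-+ : ∀ a → suc k * (a + a) ≈ a
  half-+ a = ≈-trans (≈-reflexive eq) (residues ([m+kn]%n≡m%n a a N))
    where
    eq : suc k * (a + a) ≡ a + a * N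
    eq = begin
      suc k * (a + a)         ≡⟨ *-distribˡ-+ (suc k) a a ⟩
      suc k * a + suc k * a   ≡⟨ *-distribʳ-+ a (suc k) (suc k) ⟨
      (suc k + suc k) * a     ≡⟨ cong (_* a) (cong suc (+-suc k k)) ⟩
      a + N * a               ≡⟨ cong (a +_) (*-comm N a) ⟩
      a + a * N               ∎

  half-injective : ∀ {a b} → suc k * a ≈ suc k * b → a ≈ b
  half-injective {a} {b} p = ≈-trans (≈-sym (double a)) (≈-trans (+-≈ p p) (double b))
    where
    double : ∀ a → suc k * a + suc k * a ≈ a
    double a = ≈-trans (≈-reflexive (sym (*-distribˡ-+ (suc k) a a))) (half-+ a)

  mid-≈ : ∀ x y x′ y′ → mid x y ≡ mid x′ y′ → toℕ x + toℕ y ≈ toℕ x′ + toℕ y′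
  mid-≈ x y x′ y′ = half-injective ∘ mod-≈⁻¹

  midpoint : IdempotentQuasigroup N
  midpoint = record
    { _∙_     = mid
    ; idem    = λ x → toℕ-≈-injective (≈-trans (toℕ-mod _) (half-+ (toℕ x)))
    ; cancelˡ = mid-cancelˡ
    ; cancelʳ = λ x {y} {z} p → mid-cancelˡ x (trans (mid-comm x y) (trans p (mid-comm z x)))
    }
    where
    mid-comm : ∀ x y → mid x y ≡ mid y x
    mid-comm x y = cong (λ s → (suc k * s) mod N) (+-comm (toℕ x) (toℕ y))
    mid-cancelˡ : ∀ x {y z} → mid x y ≡ mid x z → y ≡ z
    mid-cancelˡ x {y} {z} p = toℕ-≈-injective (+-cancelˡ-≈ (toℕ x) (mid-≈ x y x z p))

  next prev : Fin N → Fin N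
  next x = (1 + toℕ x) mod N
  prev x = (neg 1 + toℕ x) mod N

  prev-next : ∀ x → prev (next x) ≡ x
  prev-next x = toℕ-≈-injective
    (≈-trans (toℕ-mod _) (≈-trans (+-≈ {neg 1} ≈-refl (toℕ-mod (1 + toℕ x))) (neg-+-+ 1 (toℕ x))))

  next-prev : ∀ x → next (prev x) ≡ x
  next-prev x = toℕ-≈-injective
    (≈-trans (toℕ-mod _) (≈-trans (+-≈ {1} ≈-refl (toℕ-mod (neg 1 + toℕ x))) (+-neg-+ 1 (toℕ x))))

  -- A positive k gives N ≥ 3, so 1 and 0 differ modulo N. For k = 0 the shift fixes the only point.
  next≢ : .{{NonZero k}} → ∀ x → next x ≢ x
  next≢ x p = 1≢0 (+-cancelˡ-≈ (toℕ x)
    (≈-trans (≈-reflexive (+-comm (toℕ x) 1))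
    (≈-trans (≈-sym (toℕ-mod (1 + toℕ x)))
             (≈-reflexive (trans (cong toℕ p) (sym (+-identityʳ (toℕ x))))))))
    where
    1≢0 : ¬ 1 ≈ 0
    1≢0 (residues q) = contradiction (trans (sym (m<n⇒m%n≡m (s≤s (≤-trans (>-nonZero⁻¹ k) (m≤m+n k k))))) q) λ ()

  -- The midpoint of x and x + 1 is x + 1/2, which determines x: double, cancel 1, and halve again.
  mid-next-injective : ∀ {x y} → mid x (next x) ≡ mid y (next y) → x ≡ y
  mid-next-injective {x} {y} p = toℕ-≈-injective
    (≈-trans (≈-sym (half-+ (toℕ x))) (≈-trans (*-≈ {suc k} ≈-refl sums) (half-+ (toℕ y))))
    where
    sum-next : ∀ x → toℕ x + toℕ (next x) ≈ 1 + (toℕ x + toℕ x)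
    sum-next x = ≈-trans (+-≈ ≈-refl (toℕ-mod (1 + toℕ x))) (≈-reflexive (+-suc (toℕ x) (toℕ x)))
    sums : toℕ x + toℕ x ≈ toℕ y + toℕ y
    sums = +-cancelˡ-≈ 1 (≈-trans (≈-sym (sum-next x)) (≈-trans (mid-≈ x (next x) y (next y) p) (sum-next y)))

-- The cells (x , next x) form a transversal off the diagonal; their symbols are moved to a new row and column.
module Prolongation {N} (Q : IdempotentQuasigroup N) (next prev : Fin N → Fin N)
  (prev-next : ∀ x → prev (next x) ≡ x) (next-prev : ∀ x → next (prev x) ≡ x)
  (next≢ : ∀ x → next x ≢ x)
  (∙-next-injective : ∀ {x y} → IdempotentQuasigroup._∙_ Q x (next x) ≡ IdempotentQuasigroup._∙_ Q y (next y) → x ≡ y)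
  where

  open IdempotentQuasigroup Q

  _⊙_ : Fin (suc N) → Fin (suc N) → Fin (suc N)
  zero  ⊙ zero  = zero
  zero  ⊙ suc y = suc (prev y ∙ y)
  suc x ⊙ zero  = suc (x ∙ next x)
  suc x ⊙ suc y with y ≟ next x
  ... | yes _ = zero
  ... | no _  = suc (x ∙ y)

  -- The transversal read by columns: its cell in column x lies in row `prev x`.
  prev-∙-injective : ∀ {x y} → prev x ∙ x ≡ prev y ∙ y → x ≡ y
  prev-∙-injective {x} {y} p = trans (sym (next-prev x)) (trans (cong next (∙-next-injective
    (trans (cong (prev x ∙_) (next-prev x)) (trans p (sym (cong (prev y ∙_) (next-prev y))))))) (next-prev y))

  ⊙-idem : ∀ x → x ⊙ x ≡ x
  ⊙-idem zero    = refl
  ⊙-idem (suc x) with x ≟ next x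
  ... | yes p = contradiction (sym p) (next≢ x)
  ... | no _  = cong suc (idem x)

  -- Row `suc x` is row x of Q with one symbol moved to the new column and `zero` put in its place,
  -- so a repetition would already occur in Q. The new row lists the symbols of the transversal,
  -- which are distinct.
  ⊙-cancelˡ : ∀ x {y z} → x ⊙ y ≡ x ⊙ z → y ≡ z
  ⊙-cancelˡ zero    {zero}  {zero}  p = refl
  ⊙-cancelˡ zero    {suc y} {suc z} p = cong suc (prev-∙-injective (suc-injective p))
  ⊙-cancelˡ (suc x) {zero}  {zero}  p = refl
  ⊙-cancelˡ (suc x) {zero}  {suc z} p with z ≟ next x
  ... | no z≢ = contradiction (sym (cancelˡ x (suc-injective p))) z≢
  ⊙-cancelˡ (suc x) {suc y} {zero}  p with y ≟ next x
  ... | no y≢ = contradiction (cancelˡ x (suc-injective p)) y≢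
  ⊙-cancelˡ (suc x) {suc y} {suc z} p with y ≟ next x | z ≟ next x
  ... | yes q | yes r = cong suc (trans q (sym r))
  ... | no _  | no _  = cong suc (cancelˡ x (suc-injective p))

  ⊙-cancelʳ : ∀ x {y z} → y ⊙ x ≡ z ⊙ x → y ≡ z
  ⊙-cancelʳ zero    {zero}  {zero}  p = refl
  ⊙-cancelʳ zero    {suc y} {suc z} p = cong suc (∙-next-injective (suc-injective p))
  ⊙-cancelʳ (suc x) {zero}  {zero}  p = refl
  ⊙-cancelʳ (suc x) {zero}  {suc z} p with x ≟ next z
  ... | no x≢ = contradiction (trans (sym (next-prev x)) (cong next (cancelʳ x (suc-injective p)))) x≢
  ⊙-cancelʳ (suc x) {suc y} {zero}  p with x ≟ next y
  ... | no x≢ = contradiction (trans (sym (next-prev x)) (cong next (sym (cancelʳ x (suc-injective p))))) x≢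
  ⊙-cancelʳ (suc x) {suc y} {suc z} p with x ≟ next y | x ≟ next z
  ... | yes q | yes r = cong suc (trans (sym (prev-next y)) (trans (cong prev (trans (sym q) r)) (prev-next z)))
  ... | no _  | no _  = cong suc (cancelʳ x (suc-injective p))

  prolongation : IdempotentQuasigroup (suc N)
  prolongation = record { _∙_ = _⊙_ ; idem = ⊙-idem ; cancelˡ = ⊙-cancelˡ ; cancelʳ = ⊙-cancelʳ }

-- Columns of a triple (x , y , v)

data Position : Set where
  inner outer : Fin 3 → Position
  apex        : Position

-- Numbers rather than relations, so that they can serve as weights in tallies. The subtractions are
-- exact complements, since all values are 0 or 1.
same mate apart cross : Position → Position → ℕ
same (inner i) (inner j) = δ i j
same (outer i) (outer j) = δ i j
same apex      apex      = 1
same _         _         = 0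
mate (inner _) (inner _) = 1
mate (outer _) (outer _) = 1
mate apex      apex      = 1
mate _         _         = 0
apart p q = 1 ∸ same p q
cross p q = 1 ∸ mate p q

δ-*-δ : ∀ {n} (i j k : Fin n) → δ i j * δ i k ≡ δ i j * δ j k
δ-*-δ i j k with i ≟ j
... | yes refl = refl
... | no _     = refl

module Columns {g : ℕ} (Q : IdempotentQuasigroup g) where

  open IdempotentQuasigroup Q

  K : Set
  K = Fin g

  τ : Fin 3 → K × K → K
  τ zero             (x , y) = x
  τ (suc zero)       (x , y) = y
  τ (suc (suc zero)) (x , y) = x ∙ y

  column : Position → (K × K) × K → K
  column (inner i) (xy , v) = τ i xy
  column (outer i) (xy , v) = τ i xy ∙ v
  column apex      (xy , v) = v

  square diagonal offDiagonal : List (K × K)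
  square      = cartesianProduct (allFin g) (allFin g)
  diagonal    = filter (uncurry _≟_) square
  offDiagonal = filter (¬? ∘ uncurry _≟_) square

  params : List (K × K) → List ((K × K) × K)
  params W = cartesianProduct W (allFin g)

  occurrences : List (K × K) → Position → K → ℕ
  occurrences W p u = ∑[ t ∈ params W ] δ (column p t) u

  joint : List (K × K) → Position → Position → K → K → ℕ
  joint W p q u w = ∑[ t ∈ params W ] (δ (column p t) u * δ (column q t) w)

  ∑-∙ˡ : ∀ x w → ∑[ y ∈ allFin g ] δ (x ∙ y) w ≡ 1
  ∑-∙ˡ x w = trans (∑-cong (allFin g) λ y → δ-\\ x y w) (∑-δ₁ (x \\ w))

  ∑-∙ʳ : ∀ y w → ∑[ x ∈ allFin g ] δ (x ∙ y) w ≡ 1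
  ∑-∙ʳ y w = trans (∑-cong (allFin g) λ x → δ-// x y w) (∑-δ₁ (w // y))

  δ-//-// : ∀ u w v → δ (u // v) (w // v) ≡ δ u w
  δ-//-// u w v = trans (sym (δ-// (u // v) v w)) (cong (λ i → δ i w) (//-∙ u v))

  joint-sym : ∀ W p q u w → joint W p q u w ≡ joint W q p w u
  joint-sym W p q u w = ∑-cong (params W) λ t → *-comm (δ (column p t) u) (δ (column q t) w)

  -- The part of the count common to the full square and the diagonal. An inner column takes each
  -- value on D pairs of W, and A, B record how two inner columns are jointly distributed; v ranges
  -- freely over K.
  module Family (W : List (K × K)) (D : ℕ) (A B : Fin 3 → Fin 3 → ℕ)
    (size    : ∑[ _ ∈ W ] 1 ≡ g * D)
    (degree  : ∀ i u → ∑[ xy ∈ W ] δ (τ i xy) u ≡ D)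
    (τ-joint : ∀ i j u w → ∑[ xy ∈ W ] (δ (τ i xy) u * δ (τ j xy) w) ≡ A i j + B i j * δ u w)
    where

    ∑-params : ∀ (f : K × K → K → ℕ) → ∑[ t ∈ params W ] f (proj₁ t) (proj₂ t) ≡ ∑[ v ∈ allFin g ] ∑[ xy ∈ W ] f xy v
    ∑-params f = trans (∑-× W (allFin g) _) (∑-swap W (allFin g) f)

    degree-∙ : ∀ i u v → ∑[ xy ∈ W ] δ (τ i xy ∙ v) u ≡ D
    degree-∙ i u v = trans (∑-cong W λ xy → δ-// (τ i xy) v u) (degree i (u // v))

    -- For fixed v, right multiplication by v permutes K, so the outer columns are distributed like
    -- the inner ones.
    τ-joint-∙ : ∀ i j u w v → ∑[ xy ∈ W ] (δ (τ i xy ∙ v) u * δ (τ j xy ∙ v) w) ≡ A i j + B i j * δ u w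
    τ-joint-∙ i j u w v = begin
      ∑[ xy ∈ W ] (δ (τ i xy ∙ v) u * δ (τ j xy ∙ v) w)        ≡⟨ ∑-cong W (λ xy → cong₂ _*_ (δ-// (τ i xy) v u) (δ-// (τ j xy) v w)) ⟩
      ∑[ xy ∈ W ] (δ (τ i xy) (u // v) * δ (τ j xy) (w // v))  ≡⟨ τ-joint i j (u // v) (w // v) ⟩
      A i j + B i j * δ (u // v) (w // v)                      ≡⟨ cong (λ d → A i j + B i j * d) (δ-//-// u w v) ⟩
      A i j + B i j * δ u w                                    ∎

    ∑-δ-const : ∀ (w : K) k → ∑[ v ∈ allFin g ] (k * δ v w) ≡ k
    ∑-δ-const w k = trans (∑-*ˡ k (allFin g) λ v → δ v w) (trans (cong (k *_) (∑-δ₁ w)) (*-identityʳ k))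

    -- At an inner or outer position each of the g values of v leaves D pairs; at the apex v is
    -- fixed and all g D pairs remain.
    occurrences-≡ : ∀ p u → occurrences W p u ≡ g * D
    occurrences-≡ (inner i) u = trans (∑-params λ xy v → δ (τ i xy) u)
      (trans (∑-cong (allFin g) λ v → degree i u) (∑-allFin-const D g))
    occurrences-≡ (outer i) u = trans (∑-params λ xy v → δ (τ i xy ∙ v) u)
      (trans (∑-cong (allFin g) λ v → degree-∙ i u v) (∑-allFin-const D g))
    occurrences-≡ apex u = trans (∑-× W (allFin g) _) (trans (∑-cong W λ _ → ∑-δ₁ u) size)

    joint-inner : ∀ i j u w → joint W (inner i) (inner j) u w ≡ g * (A i j + B i j * δ u w)
    joint-inner i j u w = trans (∑-params λ xy v → δ (τ i xy) u * δ (τ j xy) w)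
      (trans (∑-cong (allFin g) λ v → τ-joint i j u w) (∑-allFin-const _ g))

    joint-outer : ∀ i j u w → joint W (outer i) (outer j) u w ≡ g * (A i j + B i j * δ u w)
    joint-outer i j u w = trans (∑-params λ xy v → δ (τ i xy ∙ v) u * δ (τ j xy ∙ v) w)
      (trans (∑-cong (allFin g) λ v → τ-joint-∙ i j u w v) (∑-allFin-const _ g))

    joint-apex : ∀ u w → joint W apex apex u w ≡ g * D * δ u w
    joint-apex u w = begin
      joint W apex apex u w                              ≡⟨ ∑-× W (allFin g) _ ⟩
      ∑[ _ ∈ W ] ∑[ v ∈ allFin g ] (δ v u * δ v w)       ≡⟨ ∑-cong W (λ _ → ∑-δ u (λ v → δ v w)) ⟩
      ∑[ _ ∈ W ] δ u w                                   ≡⟨ ∑-cong W (λ _ → sym (*-identityˡ (δ u w))) ⟩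
      ∑[ _ ∈ W ] (1 * δ u w)                             ≡⟨ ∑-*ʳ (δ u w) W (λ _ → 1) ⟩
      ∑[ _ ∈ W ] 1 * δ u w                               ≡⟨ cong (_* δ u w) size ⟩
      g * D * δ u w                                      ∎

    -- The inner value leaves D pairs, and for each of them the outer value determines v.
    joint-inner-outer : ∀ i j u w → joint W (inner i) (outer j) u w ≡ D
    joint-inner-outer i j u w = begin
      joint W (inner i) (outer j) u w                                        ≡⟨ ∑-× W (allFin g) _ ⟩
      ∑[ xy ∈ W ] ∑[ v ∈ allFin g ] (δ (τ i xy) u * δ (τ j xy ∙ v) w)        ≡⟨ ∑-cong W (λ xy → ∑-*ˡ (δ (τ i xy) u) (allFin g) (λ v → δ (τ j xy ∙ v) w)) ⟩
      ∑[ xy ∈ W ] (δ (τ i xy) u * ∑[ v ∈ allFin g ] δ (τ j xy ∙ v) w)        ≡⟨ ∑-cong W (λ xy → cong (δ (τ i xy) u *_) (∑-∙ˡ (τ j xy) w)) ⟩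
      ∑[ xy ∈ W ] (δ (τ i xy) u * 1)                                         ≡⟨ ∑-cong W (λ xy → *-identityʳ (δ (τ i xy) u)) ⟩
      ∑[ xy ∈ W ] δ (τ i xy) u                                               ≡⟨ degree i u ⟩
      D                                                                      ∎

    joint-inner-apex : ∀ i u w → joint W (inner i) apex u w ≡ D
    joint-inner-apex i u w = begin
      joint W (inner i) apex u w                                       ≡⟨ ∑-params (λ xy v → δ (τ i xy) u * δ v w) ⟩
      ∑[ v ∈ allFin g ] ∑[ xy ∈ W ] (δ (τ i xy) u * δ v w)             ≡⟨ ∑-cong (allFin g) (λ v → trans (∑-*ʳ (δ v w) W (λ xy → δ (τ i xy) u)) (cong (_* δ v w) (degree i u))) ⟩
      ∑[ v ∈ allFin g ] (D * δ v w)                                    ≡⟨ ∑-δ-const w D ⟩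
      D                                                                ∎

    joint-outer-apex : ∀ i u w → joint W (outer i) apex u w ≡ D
    joint-outer-apex i u w = begin
      joint W (outer i) apex u w                                       ≡⟨ ∑-params (λ xy v → δ (τ i xy ∙ v) u * δ v w) ⟩
      ∑[ v ∈ allFin g ] ∑[ xy ∈ W ] (δ (τ i xy ∙ v) u * δ v w)         ≡⟨ ∑-cong (allFin g) (λ v → trans (∑-*ʳ (δ v w) W (λ xy → δ (τ i xy ∙ v) u)) (cong (_* δ v w) (degree-∙ i u v))) ⟩
      ∑[ v ∈ allFin g ] (D * δ v w)                                    ≡⟨ ∑-δ-const w D ⟩
      D                                                                ∎

  ∑-square : ∀ f → ∑ square f ≡ ∑[ x ∈ allFin g ] ∑[ y ∈ allFin g ] f (x , y)
  ∑-square f = ∑-× (allFin g) (allFin g) f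

  square-size : ∑[ _ ∈ square ] 1 ≡ g * g
  square-size = trans (∑-square _) (trans (∑-cong (allFin g) λ _ → trans (∑-allFin-const 1 g) (*-identityʳ g)) (∑-allFin-const g g))

  square-degree : ∀ i u → ∑[ xy ∈ square ] δ (τ i xy) u ≡ g
  square-degree zero u = trans (∑-square _) (trans (∑-swap (allFin g) (allFin g) λ x _ → δ x u)
    (trans (∑-cong (allFin g) λ _ → ∑-δ₁ u) (trans (∑-allFin-const 1 g) (*-identityʳ g))))
  square-degree (suc zero) u = trans (∑-square _)
    (trans (∑-cong (allFin g) λ _ → ∑-δ₁ u) (trans (∑-allFin-const 1 g) (*-identityʳ g)))
  square-degree (suc (suc zero)) u = trans (∑-square _)
    (trans (∑-cong (allFin g) λ x → ∑-∙ˡ x u) (trans (∑-allFin-const 1 g) (*-identityʳ g)))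

  -- The factor 1 is `δ i i` evaluated, so that this matches the equal cases of `square-joint` by
  -- computation.
  square-joint-self : ∀ i u w → ∑[ xy ∈ square ] (δ (τ i xy) u * δ (τ i xy) w) ≡ g * 1 * δ u w
  square-joint-self i u w = begin
    ∑[ xy ∈ square ] (δ (τ i xy) u * δ (τ i xy) w) ≡⟨ ∑-cong square (λ xy → δ-*-δ (τ i xy) u w) ⟩
    ∑[ xy ∈ square ] (δ (τ i xy) u * δ u w)        ≡⟨ ∑-*ʳ (δ u w) square (λ xy → δ (τ i xy) u) ⟩
    ∑[ xy ∈ square ] δ (τ i xy) u * δ u w          ≡⟨ cong (_* δ u w) (trans (square-degree i u) (sym (*-identityʳ g))) ⟩
    g * 1 * δ u w                                  ∎

  square-joint₀₁ : ∀ u w → ∑[ xy ∈ square ] (δ (proj₁ xy) u * δ (proj₂ xy) w) ≡ 1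
  square-joint₀₁ u w = trans (∑-square _) (trans (sym (∑-* (allFin g) (allFin g) (λ x → δ x u) (λ y → δ y w)))
    (cong₂ _*_ (∑-δ₁ u) (∑-δ₁ w)))

  square-joint₀₂ : ∀ u w → ∑[ xy ∈ square ] (δ (proj₁ xy) u * δ (proj₁ xy ∙ proj₂ xy) w) ≡ 1
  square-joint₀₂ u w = begin
    ∑[ xy ∈ square ] (δ (proj₁ xy) u * δ (proj₁ xy ∙ proj₂ xy) w)         ≡⟨ ∑-square _ ⟩
    ∑[ x ∈ allFin g ] ∑[ y ∈ allFin g ] (δ x u * δ (x ∙ y) w)             ≡⟨ ∑-cong (allFin g) (λ x → ∑-*ˡ (δ x u) (allFin g) (λ y → δ (x ∙ y) w)) ⟩
    ∑[ x ∈ allFin g ] (δ x u * ∑[ y ∈ allFin g ] δ (x ∙ y) w)             ≡⟨ ∑-δ u (λ x → ∑[ y ∈ allFin g ] δ (x ∙ y) w) ⟩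
    ∑[ y ∈ allFin g ] δ (u ∙ y) w                                         ≡⟨ ∑-∙ˡ u w ⟩
    1                                                                     ∎

  square-joint₁₂ : ∀ u w → ∑[ xy ∈ square ] (δ (proj₂ xy) u * δ (proj₁ xy ∙ proj₂ xy) w) ≡ 1
  square-joint₁₂ u w = begin
    ∑[ xy ∈ square ] (δ (proj₂ xy) u * δ (proj₁ xy ∙ proj₂ xy) w)         ≡⟨ ∑-square _ ⟩
    ∑[ x ∈ allFin g ] ∑[ y ∈ allFin g ] (δ y u * δ (x ∙ y) w)             ≡⟨ ∑-cong (allFin g) (λ x → ∑-δ u (λ y → δ (x ∙ y) w)) ⟩
    ∑[ x ∈ allFin g ] δ (x ∙ u) w                                         ≡⟨ ∑-∙ʳ u w ⟩
    1                                                                     ∎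

  square-comm : ∀ i j u w → ∑[ xy ∈ square ] (δ (τ i xy) u * δ (τ j xy) w) ≡ ∑[ xy ∈ square ] (δ (τ j xy) w * δ (τ i xy) u)
  square-comm i j u w = ∑-cong square λ xy → *-comm (δ (τ i xy) u) (δ (τ j xy) w)

  1≡1+g*0 : ∀ (u w : K) → 1 ≡ 1 + g * 0 * δ u w
  1≡1+g*0 u w = cong suc (sym (cong (_* δ u w) (*-zeroʳ g)))

  -- Any two of x, y and x ∙ y take prescribed values for exactly one pair: the cells of a Latin
  -- square form an orthogonal array of strength two.
  square-joint : ∀ i j u w → ∑[ xy ∈ square ] (δ (τ i xy) u * δ (τ j xy) w) ≡ (1 ∸ δ i j) + g * δ i j * δ u w
  square-joint zero             zero             u w = square-joint-self zero u w
  square-joint (suc zero)       (suc zero)       u w = square-joint-self (suc zero) u w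
  square-joint (suc (suc zero)) (suc (suc zero)) u w = square-joint-self (suc (suc zero)) u w
  square-joint zero             (suc zero)       u w = trans (square-joint₀₁ u w) (1≡1+g*0 u w)
  square-joint zero             (suc (suc zero)) u w = trans (square-joint₀₂ u w) (1≡1+g*0 u w)
  square-joint (suc zero)       (suc (suc zero)) u w = trans (square-joint₁₂ u w) (1≡1+g*0 u w)
  square-joint (suc zero)       zero             u w = trans (square-comm (suc zero) zero u w) (trans (square-joint₀₁ w u) (1≡1+g*0 u w))
  square-joint (suc (suc zero)) zero             u w = trans (square-comm (suc (suc zero)) zero u w) (trans (square-joint₀₂ w u) (1≡1+g*0 u w))
  square-joint (suc (suc zero)) (suc zero)       u w = trans (square-comm (suc (suc zero)) (suc zero) u w) (trans (square-joint₁₂ w u) (1≡1+g*0 u w))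

  ∑-diagonal : ∀ f → ∑ diagonal f ≡ ∑[ x ∈ allFin g ] f (x , x)
  ∑-diagonal f = begin
    ∑ diagonal f                                                     ≡⟨ ∑-filter (uncurry _≟_) square f ⟩
    ∑[ xy ∈ square ] (𝟙 (uncurry _≟_ xy) * f xy)                     ≡⟨ ∑-square _ ⟩
    ∑[ x ∈ allFin g ] ∑[ y ∈ allFin g ] (δ x y * f (x , y))          ≡⟨ ∑-cong (allFin g) (λ x → ∑-cong (allFin g) λ y → cong (_* f (x , y)) (δ-sym x y)) ⟩
    ∑[ x ∈ allFin g ] ∑[ y ∈ allFin g ] (δ y x * f (x , y))          ≡⟨ ∑-cong (allFin g) (λ x → ∑-δ x (λ y → f (x , y))) ⟩
    ∑[ x ∈ allFin g ] f (x , x)                                      ∎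

  -- Idempotence makes the three inner columns agree on the diagonal.
  τ-diagonal : ∀ i x → τ i (x , x) ≡ x
  τ-diagonal zero             x = refl
  τ-diagonal (suc zero)       x = refl
  τ-diagonal (suc (suc zero)) x = idem x

  diagonal-degree : ∀ i u → ∑[ xy ∈ diagonal ] δ (τ i xy) u ≡ 1
  diagonal-degree i u = trans (∑-diagonal _) (trans (∑-cong (allFin g) λ x → cong (λ z → δ z u) (τ-diagonal i x)) (∑-δ₁ u))

  diagonal-joint : ∀ i j u w → ∑[ xy ∈ diagonal ] (δ (τ i xy) u * δ (τ j xy) w) ≡ 0 + 1 * δ u w
  diagonal-joint i j u w = begin
    ∑[ xy ∈ diagonal ] (δ (τ i xy) u * δ (τ j xy) w)  ≡⟨ ∑-diagonal _ ⟩
    ∑[ x ∈ allFin g ] (δ (τ i (x , x)) u * δ (τ j (x , x)) w) ≡⟨ ∑-cong (allFin g) (λ x → cong₂ (λ y z → δ y u * δ z w) (τ-diagonal i x) (τ-diagonal j x)) ⟩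
    ∑[ x ∈ allFin g ] (δ x u * δ x w)                 ≡⟨ ∑-δ u (λ x → δ x w) ⟩
    δ u w                                             ≡⟨ *-identityˡ (δ u w) ⟨
    1 * δ u w                                         ∎

  diagonal-size : ∑[ _ ∈ diagonal ] 1 ≡ g * 1
  diagonal-size = trans (∑-diagonal _) (∑-allFin-const 1 g)

  module Square   = Family square g (λ i j → 1 ∸ δ i j) (λ i j → g * δ i j) square-size square-degree square-joint
  module Diagonal = Family diagonal 1 (λ _ _ → 0) (λ _ _ → 1) diagonal-size diagonal-degree diagonal-joint

  -- These identities bring every count to the shape x * r + y * s, with weights r and s of
  -- positions, that `coincidences-linear` takes as its hypothesis.
  module _ where
    open +-*-Solver

    within-square : ∀ a s d → g * (a + g * s * d) ≡ g * a + g * g * d * s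
    within-square = solve 4 (λ g a s d → g :* (a :+ g :* s :* d) := g :* a :+ g :* g :* d :* s) refl g

    within-diagonal : ∀ d → g * (0 + 1 * d) ≡ 1 * 0 + g * d * 1
    within-diagonal = solve 2 (λ g d → g :* (con 0 :+ con 1 :* d) := con 1 :* con 0 :+ g :* d :* con 1) refl g

    apex-square : ∀ d → g * g * d ≡ g * 0 + g * g * d * 1
    apex-square = solve 2 (λ g d → g :* g :* d := g :* con 0 :+ g :* g :* d :* con 1) refl g

    apex-diagonal : ∀ d → g * 1 * d ≡ 1 * 0 + g * d * 1
    apex-diagonal = solve 2 (λ g d → g :* con 1 :* d := con 1 :* con 0 :+ g :* d :* con 1) refl g

    across : ∀ k l → k ≡ k * 1 + l * 0
    across = solve 2 (λ k l → k := k :* con 1 :+ l :* con 0) refl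

  square-joint-≡ : ∀ p q u w → joint square p q u w ≡ g * apart p q + g * g * δ u w * same p q
  square-joint-≡ (inner i) (inner j) u w = trans (Square.joint-inner i j u w) (within-square (1 ∸ δ i j) (δ i j) (δ u w))
  square-joint-≡ (outer i) (outer j) u w = trans (Square.joint-outer i j u w) (within-square (1 ∸ δ i j) (δ i j) (δ u w))
  square-joint-≡ apex      apex      u w = trans (Square.joint-apex u w) (apex-square (δ u w))
  square-joint-≡ (inner i) (outer j) u w = trans (Square.joint-inner-outer i j u w) (across g (g * g * δ u w))
  square-joint-≡ (inner i) apex      u w = trans (Square.joint-inner-apex i u w) (across g (g * g * δ u w))
  square-joint-≡ (outer i) apex      u w = trans (Square.joint-outer-apex i u w) (across g (g * g * δ u w))
  square-joint-≡ (outer i) (inner j) u w = trans (joint-sym square (outer i) (inner j) u w) (trans (Square.joint-inner-outer j i w u) (across g (g * g * δ u w)))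
  square-joint-≡ apex      (inner j) u w = trans (joint-sym square apex (inner j) u w) (trans (Square.joint-inner-apex j w u) (across g (g * g * δ u w)))
  square-joint-≡ apex      (outer j) u w = trans (joint-sym square apex (outer j) u w) (trans (Square.joint-outer-apex j w u) (across g (g * g * δ u w)))

  diagonal-joint-≡ : ∀ p q u w → joint diagonal p q u w ≡ 1 * cross p q + g * δ u w * mate p q
  diagonal-joint-≡ (inner i) (inner j) u w = trans (Diagonal.joint-inner i j u w) (within-diagonal (δ u w))
  diagonal-joint-≡ (outer i) (outer j) u w = trans (Diagonal.joint-outer i j u w) (within-diagonal (δ u w))
  diagonal-joint-≡ apex      apex      u w = trans (Diagonal.joint-apex u w) (apex-diagonal (δ u w))
  diagonal-joint-≡ (inner i) (outer j) u w = trans (Diagonal.joint-inner-outer i j u w) (across 1 (g * δ u w))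
  diagonal-joint-≡ (inner i) apex      u w = trans (Diagonal.joint-inner-apex i u w) (across 1 (g * δ u w))
  diagonal-joint-≡ (outer i) apex      u w = trans (Diagonal.joint-outer-apex i u w) (across 1 (g * δ u w))
  diagonal-joint-≡ (outer i) (inner j) u w = trans (joint-sym diagonal (outer i) (inner j) u w) (trans (Diagonal.joint-inner-outer j i w u) (across 1 (g * δ u w)))
  diagonal-joint-≡ apex      (inner j) u w = trans (joint-sym diagonal apex (inner j) u w) (trans (Diagonal.joint-inner-apex j w u) (across 1 (g * δ u w)))
  diagonal-joint-≡ apex      (outer j) u w = trans (joint-sym diagonal apex (outer j) u w) (trans (Diagonal.joint-outer-apex j w u) (across 1 (g * δ u w)))

  -- Counts off the diagonal are obtained through this sum from those over the square and the
  -- diagonal, and never directly.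
  offDiagonal+diagonal : ∀ f → ∑ (params offDiagonal) f + ∑ (params diagonal) f ≡ ∑ (params square) f
  offDiagonal+diagonal f = begin
    ∑ (params offDiagonal) f + ∑ (params diagonal) f ≡⟨ cong₂ _+_ (∑-× offDiagonal (allFin g) f) (∑-× diagonal (allFin g) f) ⟩
    ∑ offDiagonal F + ∑ diagonal F                   ≡⟨ ∑-partition (uncurry _≟_) square F ⟩
    ∑ square F                                       ≡⟨ ∑-× square (allFin g) f ⟨
    ∑ (params square) f                              ∎
    where
    F : K × K → ℕ
    F xy = ∑[ v ∈ allFin g ] f (xy , v)

  -- If x = x ∙ y, then x ∙ x = x ∙ y by idempotence and x = y by cancellation; likewise for y. So
  -- x, y and x ∙ y are distinct off the diagonal.
  τ-separates : ∀ i j {x y} → x ≢ y → τ i (x , y) ≡ τ j (x , y) → i ≡ j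
  τ-separates zero             zero             x≢y p = refl
  τ-separates (suc zero)       (suc zero)       x≢y p = refl
  τ-separates (suc (suc zero)) (suc (suc zero)) x≢y p = refl
  τ-separates zero             (suc zero)       x≢y p = contradiction p x≢y
  τ-separates (suc zero)       zero             x≢y p = contradiction (sym p) x≢y
  τ-separates zero             (suc (suc zero)) x≢y p = contradiction (cancelˡ _ (trans (idem _) p)) x≢y
  τ-separates (suc (suc zero)) zero             x≢y p = contradiction (cancelˡ _ (trans (idem _) (sym p))) x≢y
  τ-separates (suc zero)       (suc (suc zero)) x≢y p = contradiction (sym (cancelʳ _ (trans (idem _) p))) x≢y
  τ-separates (suc (suc zero)) (suc zero)       x≢y p = contradiction (cancelʳ _ (trans p (sym (idem _)))) x≢y

  -- Lets a generic pattern give one colour to several positions of a class: their values still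
  -- differ off the diagonal. Outer positions reduce to inner ones by cancelling v.
  column-separates : ∀ p q {x y v} → mate p q ≡ 1 → same p q ≡ 0 → x ≢ y →
    column p ((x , y) , v) ≢ column q ((x , y) , v)
  column-separates (inner i) (inner j) _ s x≢y eq with refl ← τ-separates i j x≢y eq = contradiction (trans (sym (δ-refl i)) s) λ ()
  column-separates (outer i) (outer j) _ s x≢y eq with refl ← τ-separates i j x≢y (cancelʳ _ eq) = contradiction (trans (sym (δ-refl i)) s) λ ()
  column-separates apex      apex      _ ()

-- Coloured patterns

Entry Pattern : Set
Entry   = Position × ℕ
Pattern = List Entry

module Colours (C : ℕ) .{{_ : NonZero C}} where

  open Modular C

  infixl 6 _⊕_
  _⊕_ : ℕ → Fin C → Fin C
  a ⊕ e = (a + toℕ e) mod C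

  gap : Fin C → Fin C → Fin C
  gap k l = (neg (toℕ k) + toℕ l) mod C

  -- Tests b − a ≡ d (mod C), with a moved across so that no subtraction occurs.
  hit : ℕ → ℕ → ℕ → ℕ
  hit a b d = 𝟙 ((a + d) % C ≟ℕ b % C)

  -- The list of differences of a difference family, weighted by r: ordered pairs of entries of one
  -- pattern whose colours differ by d. An entry paired with itself counts only when d is 0 modulo
  -- C.
  tally : (Position → Position → ℕ) → List Pattern → ℕ → ℕ
  tally r Ps d = ∑[ P ∈ Ps ] ∑[ (p , a) ∈ P ] ∑[ (q , b) ∈ P ] (hit a b d * r p q)

  +-gap : ∀ k l → toℕ k + toℕ (gap k l) ≈ toℕ l
  +-gap k l = ≈-trans (+-≈ {toℕ k} ≈-refl (toℕ-mod _)) (+-neg-+ (toℕ k) (toℕ l))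

  -- The difference k - a in Z_C, the only translate that brings colour a to k.
  origin : ℕ → Fin C → Fin C
  origin a k = (neg a + toℕ k) mod C

  +-origin : ∀ a k → a + toℕ (origin a k) ≈ toℕ k
  +-origin a k = ≈-trans (+-≈ {a} ≈-refl (toℕ-mod _)) (+-neg-+ a (toℕ k))

  ⊕-≈ : ∀ a e {k} → a ⊕ e ≡ k → a + toℕ e ≈ toℕ k
  ⊕-≈ a e p = ≈-trans (≈-sym (toℕ-mod (a + toℕ e))) (≈-reflexive (cong toℕ p))

  ≈-⊕ : ∀ a e {k} → a + toℕ e ≈ toℕ k → a ⊕ e ≡ k
  ≈-⊕ a e p = toℕ-≈-injective (≈-trans (toℕ-mod (a + toℕ e)) p)

  δ-⊕ : ∀ a e k → δ (a ⊕ e) k ≡ δ e (origin a k)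
  δ-⊕ a e k = 𝟙-⇔ (a ⊕ e ≟ k) (e ≟ origin a k)
    (λ p → toℕ-≈-injective (+-cancelˡ-≈ a (≈-trans (⊕-≈ a e p) (≈-sym (+-origin a k)))))
    (λ { refl → ≈-⊕ a _ (+-origin a k) })

  ∑-⊕ : ∀ a k → ∑[ e ∈ allFin C ] δ (a ⊕ e) k ≡ 1
  ∑-⊕ a k = trans (∑-cong (allFin C) λ e → δ-⊕ a e k) (∑-δ₁ (origin a k))

  -- Exactly one translate carries a to k, and it carries b to l exactly when b - a = l - k.
  ∑-⊕-⊕ : ∀ a b k l → ∑[ e ∈ allFin C ] (δ (a ⊕ e) k * δ (b ⊕ e) l) ≡ hit a b (toℕ (gap k l))
  ∑-⊕-⊕ a b k l = begin
    ∑[ e ∈ allFin C ] (δ (a ⊕ e) k * δ (b ⊕ e) l)         ≡⟨ ∑-cong (allFin C) (λ e → cong (_* δ (b ⊕ e) l) (δ-⊕ a e k)) ⟩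
    ∑[ e ∈ allFin C ] (δ e (origin a k) * δ (b ⊕ e) l)    ≡⟨ ∑-δ (origin a k) (λ e → δ (b ⊕ e) l) ⟩
    δ (b ⊕ o) l                                           ≡⟨ 𝟙-⇔ (b ⊕ o ≟ l) ((a + d) % C ≟ℕ b % C) to from ⟩
    hit a b d                                             ∎
    where
    o = origin a k
    d = toℕ (gap k l)
    o+a+d≈l : toℕ o + (a + d) ≈ toℕ l
    o+a+d≈l = ≈-trans (≈-reflexive (trans (sym (+-assoc (toℕ o) a d)) (cong (_+ d) (+-comm (toℕ o) a))))
      (≈-trans (+-≈ (+-origin a k) (≈-refl {d})) (+-gap k l))
    to : b ⊕ o ≡ l → (a + d) % C ≡ b % C
    to p = residue-≡ (+-cancelˡ-≈ (toℕ o) (≈-trans o+a+d≈l (≈-trans (≈-sym (⊕-≈ b o p)) (≈-reflexive (+-comm b (toℕ o))))))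
    from : (a + d) % C ≡ b % C → b ⊕ o ≡ l
    from p = ≈-⊕ b o (≈-trans (≈-reflexive (+-comm b (toℕ o))) (≈-trans (+-≈ {toℕ o} ≈-refl (≈-sym (residues p))) o+a+d≈l))

  -- Separates the factors k and l, which will carry g and the values of the two points, from
  -- tallies that depend on the patterns alone.
  tally-linear : ∀ k l (r s : Position → Position → ℕ) Ps d →
    ∑[ P ∈ Ps ] ∑[ (p , a) ∈ P ] ∑[ (q , b) ∈ P ] (hit a b d * (k * r p q + l * s p q)) ≡
    k * tally r Ps d + l * tally s Ps d
  tally-linear k l r s Ps d =
    combine-linear Ps λ P → combine-linear P λ (p , a) → combine-linear P λ (q , b) → distribute (hit a b d) (r p q) (s p q)
    where
    combine-linear : ∀ {A : Set} (xs : List A) {f h₁ h₂ : A → ℕ} →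
      (∀ x → f x ≡ k * h₁ x + l * h₂ x) → ∑ xs f ≡ k * ∑ xs h₁ + l * ∑ xs h₂
    combine-linear xs {f} {h₁} {h₂} eq = trans (∑-cong xs eq)
      (trans (∑-+ xs (λ x → k * h₁ x) (λ x → l * h₂ x)) (cong₂ _+_ (∑-*ˡ k xs h₁) (∑-*ˡ l xs h₂)))
    distribute : ∀ h x y → h * (k * x + l * y) ≡ k * (h * x) + l * (h * y)
    distribute = solve 5 (λ k l h x y → h :* (k :* x :+ l :* y) := k :* (h :* x) :+ l :* (h :* y)) refl k l
      where open +-*-Solver

  -- Counting points and pairs of points over all translates and triples.

  module Counting {g : ℕ} (Q : IdempotentQuasigroup g) where

    open Columns Q

    Point : Set
    Point = Fin C × K

    Index : Set
    Index = Pattern × (Fin C × ((K × K) × K))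

    point : Fin C × ((K × K) × K) → Entry → Point
    point (e , t) (p , a) = a ⊕ e , column p t

    points : Index → List Point
    points (P , s) = map (point s) P

    indices : List (K × K) → List Pattern → List Index
    indices W Ps = cartesianProduct Ps (cartesianProduct (allFin C) (params W))

    δₚ : Point → Point → ℕ
    δₚ (k , u) (l , w) = δ k l * δ u w

    -- Counted with repetition, because the generic patterns are also summed over the diagonal,
    -- where their points may coincide.
    multiplicity : Index → Point → ℕ
    multiplicity i X = ∑[ Y ∈ points i ] δₚ Y X

    ∑-separate : ∀ T f h → ∑[ s ∈ cartesianProduct (allFin C) (params T) ] (f (proj₁ s) * h (proj₂ s)) ≡ ∑ (allFin C) f * ∑ (params T) h
    ∑-separate T f h = trans (∑-× (allFin C) (params T) _) (sym (∑-* (allFin C) (params T) f h))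

    -- Each of the six entries of a pattern meets X for one translate and D triples.
    replications : ∀ W {D} Ps → (∀ p u → occurrences W p u ≡ D) → All (λ P → length P ≡ 6) Ps →
      ∀ X → ∑[ i ∈ indices W Ps ] multiplicity i X ≡ length Ps * (6 * D)
    replications W {D} Ps occ six (k , u) = trans (∑-× Ps S _) (trans (∑-congᴬ (All.map (λ {P} → each P) six)) (∑-const (6 * D) Ps))
      where
      S = cartesianProduct (allFin C) (params W)
      each : ∀ P → length P ≡ 6 → ∑[ s ∈ S ] multiplicity (P , s) (k , u) ≡ 6 * D
      each P eq = begin
        ∑[ s ∈ S ] multiplicity (P , s) (k , u)                                          ≡⟨ ∑-cong S (λ s → ∑-map (point s) P (λ Y → δₚ Y (k , u))) ⟩
        ∑[ s ∈ S ] ∑[ (p , a) ∈ P ] (δ (a ⊕ proj₁ s) k * δ (column p (proj₂ s)) u)       ≡⟨ ∑-swap S P (λ { s (p , a) → δ (a ⊕ proj₁ s) k * δ (column p (proj₂ s)) u }) ⟩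
        ∑[ (p , a) ∈ P ] ∑[ s ∈ S ] (δ (a ⊕ proj₁ s) k * δ (column p (proj₂ s)) u)       ≡⟨ ∑-cong P (λ (p , a) → trans (∑-separate W (λ e → δ (a ⊕ e) k) (λ t → δ (column p t) u)) (trans (cong₂ _*_ (∑-⊕ a k) (occ p u)) (*-identityˡ D))) ⟩
        ∑[ _ ∈ P ] D                                                                     ≡⟨ ∑-const D P ⟩
        length P * D                                                                     ≡⟨ cong (_* D) eq ⟩
        6 * D                                                                            ∎

    coincidences : List (K × K) → List Pattern → Point → Point → ℕ
    coincidences W Ps X Y = ∑[ i ∈ indices W Ps ] (multiplicity i X * multiplicity i Y)

    -- Colours depend only on the translate and values only on the triple, so the sum for each pair
    -- of entries factors.
    coincidences-≡ : ∀ W Ps k l u w → coincidences W Ps (k , u) (l , w) ≡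
      ∑[ P ∈ Ps ] ∑[ (p , a) ∈ P ] ∑[ (q , b) ∈ P ] (hit a b (toℕ (gap k l)) * joint W p q u w)
    coincidences-≡ W Ps k l u w = trans (∑-× Ps S _) (∑-cong Ps each)
      where
      S = cartesianProduct (allFin C) (params W)
      X = (k , u)
      Y = (l , w)
      term : Fin C × ((K × K) × K) → Entry → Entry → ℕ
      term (e , t) (p , a) (q , b) = (δ (a ⊕ e) k * δ (b ⊕ e) l) * (δ (column p t) u * δ (column q t) w)
      each : ∀ P → ∑[ s ∈ S ] (multiplicity (P , s) X * multiplicity (P , s) Y) ≡
        ∑[ (p , a) ∈ P ] ∑[ (q , b) ∈ P ] (hit a b (toℕ (gap k l)) * joint W p q u w)
      each P = begin
        ∑[ s ∈ S ] (multiplicity (P , s) X * multiplicity (P , s) Y)                     ≡⟨ ∑-cong S (λ s → cong₂ _*_ (∑-map (point s) P (λ Z → δₚ Z X)) (∑-map (point s) P (λ Z → δₚ Z Y))) ⟩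
        ∑[ s ∈ S ] (∑[ x ∈ P ] δₚ (point s x) X * ∑[ y ∈ P ] δₚ (point s y) Y)           ≡⟨ ∑-cong S (λ s → ∑-* P P (λ x → δₚ (point s x) X) (λ y → δₚ (point s y) Y)) ⟩
        ∑[ s ∈ S ] ∑[ x ∈ P ] ∑[ y ∈ P ] (δₚ (point s x) X * δₚ (point s y) Y)           ≡⟨ ∑-cong S (λ s → ∑-cong P λ x → ∑-cong P λ y → *-interchange (δ (proj₂ x ⊕ proj₁ s) k) _ (δ (proj₂ y ⊕ proj₁ s) l) _) ⟩
        ∑[ s ∈ S ] ∑[ x ∈ P ] ∑[ y ∈ P ] term s x y                                      ≡⟨ ∑-swap S P (λ s x → ∑[ y ∈ P ] term s x y) ⟩
        ∑[ x ∈ P ] ∑[ s ∈ S ] ∑[ y ∈ P ] term s x y                                      ≡⟨ ∑-cong P (λ x → ∑-swap S P λ s y → term s x y) ⟩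
        ∑[ x ∈ P ] ∑[ y ∈ P ] ∑[ s ∈ S ] term s x y                                      ≡⟨ ∑-cong P (λ (p , a) → ∑-cong P λ (q , b) → trans (∑-separate W (λ e → δ (a ⊕ e) k * δ (b ⊕ e) l) (λ t → δ (column p t) u * δ (column q t) w)) (cong (_* joint W p q u w) (∑-⊕-⊕ a b k l))) ⟩
        ∑[ (p , a) ∈ P ] ∑[ (q , b) ∈ P ] (hit a b (toℕ (gap k l)) * joint W p q u w)    ∎

    coincidences-linear : ∀ W Ps k l u w (x y : ℕ) (r s : Position → Position → ℕ) →
      (∀ p q → joint W p q u w ≡ x * r p q + y * s p q) →
      coincidences W Ps (k , u) (l , w) ≡ x * tally r Ps (toℕ (gap k l)) + y * tally s Ps (toℕ (gap k l))
    coincidences-linear W Ps k l u w x y r s eq = trans (coincidences-≡ W Ps k l u w)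
      (trans (∑-cong Ps λ P → ∑-cong P λ (p , a) → ∑-cong P λ (q , b) → cong (hit a b (toℕ (gap k l)) *_) (eq p q))
             (tally-linear x y r s Ps (toℕ (gap k l))))

    square-coincidences : ∀ Ps k l u w → let d = toℕ (gap k l) in
      coincidences square Ps (k , u) (l , w) ≡ g * tally apart Ps d + g * g * δ u w * tally same Ps d
    square-coincidences Ps k l u w = coincidences-linear square Ps k l u w g (g * g * δ u w) apart same λ p q → square-joint-≡ p q u w

    diagonal-coincidences : ∀ Ps k l u w → let d = toℕ (gap k l) in
      coincidences diagonal Ps (k , u) (l , w) ≡ 1 * tally cross Ps d + g * δ u w * tally mate Ps d
    diagonal-coincidences Ps k l u w = coincidences-linear diagonal Ps k l u w 1 (g * δ u w) cross mate λ p q → diagonal-joint-≡ p q u w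

    ∑-offDiagonal : ∀ Ps f → ∑ (indices offDiagonal Ps) f + ∑ (indices diagonal Ps) f ≡ ∑ (indices square Ps) f
    ∑-offDiagonal Ps f = begin
      ∑ (indices offDiagonal Ps) f + ∑ (indices diagonal Ps) f                     ≡⟨ cong₂ _+_ (split offDiagonal) (split diagonal) ⟩
      ∑[ P ∈ Ps ] ∑[ e ∈ allFin C ] F offDiagonal P e + ∑[ P ∈ Ps ] ∑[ e ∈ allFin C ] F diagonal P e
        ≡⟨ ∑-+ Ps (λ P → ∑[ e ∈ allFin C ] F offDiagonal P e) (λ P → ∑[ e ∈ allFin C ] F diagonal P e) ⟨
      ∑[ P ∈ Ps ] (∑[ e ∈ allFin C ] F offDiagonal P e + ∑[ e ∈ allFin C ] F diagonal P e)
        ≡⟨ ∑-cong Ps (λ P → trans (sym (∑-+ (allFin C) (F offDiagonal P) (F diagonal P))) (∑-cong (allFin C) λ e → offDiagonal+diagonal λ t → f (P , e , t))) ⟩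
      ∑[ P ∈ Ps ] ∑[ e ∈ allFin C ] F square P e                                   ≡⟨ split square ⟨
      ∑ (indices square Ps) f                                                      ∎
      where
      F : List (K × K) → Pattern → Fin C → ℕ
      F W P e = ∑[ t ∈ params W ] f (P , e , t)
      split : ∀ W → ∑ (indices W Ps) f ≡ ∑[ P ∈ Ps ] ∑[ e ∈ allFin C ] F W P e
      split W = trans (∑-× Ps _ f) (∑-cong Ps λ P → ∑-× (allFin C) (params W) λ s → f (P , s))

-- Conditions on a system of patterns.

census : Pattern → Fin 2 → ℕ → ℕ
census P i e = ∑[ (_ , a) ∈ P ] δ ((a + e) mod 2) i

OneFive : ℕ → ℕ → Set
OneFive m n = (m ≡ 1 × n ≡ 5) ⊎ (m ≡ 5 × n ≡ 1)

-- Degenerate blocks have x = y, so their positions of one class share a value and all colours must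
-- differ. Times g, `apart-tally` is the main term 2cg or cg; `cross-tally` leaves the one by which
-- odd differences fall short. Two tallies exempt d = 0, where distinct points have distinct values
-- and `δ u w` vanishes.
record Design (c : ℕ) .{{_ : NonZero (2 * c)}} : Set where
  C : ℕ
  C = 2 * c
  open Colours C
  field
    generic degenerate  : List Pattern
    generic-distinct    : All (AllPairs λ (p , a) (q , b) → a % C ≢ b % C ⊎ mate p q ≡ 1 × same p q ≡ 0) generic
    degenerate-distinct : All (AllPairs λ (p , a) (q , b) → a % C ≢ b % C) degenerate
    generic-size        : All (λ P → length P ≡ 6) generic
    degenerate-size     : All (λ P → length P ≡ 6) degenerate
    generic-split       : All (λ P → ∀ (e : Fin 2) → OneFive (census P zero (toℕ e)) (census P (suc zero) (toℕ e))) generic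
    degenerate-split    : All (λ P → ∀ (e : Fin 2) → OneFive (census P zero (toℕ e)) (census P (suc zero) (toℕ e))) degenerate
    halves              : ∀ i → ∑[ k ∈ allFin C ] δ (toℕ k mod 2) i ≡ c
    apart-tally         : ∀ (d : Fin C) → tally apart generic (toℕ d) ≡ c * (2 ∸ toℕ d % 2)
    same-tally          : ∀ (d : Fin C) → toℕ d ≢ 0 → tally same generic (toℕ d) ≡ 0
    cross-tally         : ∀ (d : Fin C) → tally cross generic (toℕ d) ≡ tally cross degenerate (toℕ d) + toℕ d % 2
    mate-tally          : ∀ (d : Fin C) → toℕ d ≢ 0 → tally mate generic (toℕ d) ≡ tally mate degenerate (toℕ d)

-- Subsets given by characteristic functions.

𝟙-∈-tabulate : ∀ {v} (f : Fin v → Bool) z → 𝟙 (z Subset.∈? Vec.tabulate f) ≡ (if f z then 1 else 0)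
𝟙-∈-tabulate f zero with f zero
... | true  = refl
... | false = refl
𝟙-∈-tabulate f (suc z) = 𝟙-∈-tabulate (f ∘ suc) z

∣tabulate∣ : ∀ {v} (f : Fin v → Bool) → ∣ Vec.tabulate f ∣ ≡ ∑[ z ∈ allFin v ] (if f z then 1 else 0)
∣tabulate∣ {zero}  f = refl
∣tabulate∣ {suc v} f with ∣tabulate∣ (f ∘ suc) | ∑-allFin-suc v (λ z → if f z then 1 else 0)
... | ih | eq with f zero
... | true  = trans (cong suc ih) (sym eq)
... | false = trans ih (sym eq)

tabulate-∩ : ∀ {v} (f h : Fin v → Bool) → Vec.tabulate f ∩ Vec.tabulate h ≡ Vec.tabulate (λ z → f z ∧ h z)
tabulate-∩ {zero}  f h = refl
tabulate-∩ {suc v} f h = cong (f zero ∧ h zero Vec.∷_) (tabulate-∩ (f ∘ suc) (h ∘ suc))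

∣tabulate-∩∣ : ∀ {v} (f h : Fin v → Bool) →
  ∣ Vec.tabulate f ∩ Vec.tabulate h ∣ ≡ ∑[ z ∈ allFin v ] ((if f z then 1 else 0) * (if h z then 1 else 0))
∣tabulate-∩∣ {v} f h = trans (cong ∣_∣ (tabulate-∩ f h)) (trans (∣tabulate∣ (λ z → f z ∧ h z)) (∑-cong (allFin v) λ z → bits (f z) (h z)))
  where
  bits : ∀ a b → (if a ∧ b then 1 else 0) ≡ (if a then 1 else 0) * (if b then 1 else 0)
  bits true  true  = refl
  bits true  false = refl
  bits false _     = refl

-- The group divisible design of a system of patterns.

module Construction {c g : ℕ} .{{_ : NonZero (2 * c)}} (design : Design c) (Q : IdempotentQuasigroup g) where

  open Design design
  open Colours C
  open Modular C
  open Columns Q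
  open Counting Q
  private module Mod₂ = Modular 2

  _≟ₚ_ : DecidableEquality Point
  _≟ₚ_ = ≡-dec _≟_ _≟_

  open DecMembership _≟ₚ_ using (_∈?_; _∈_)

  v : ℕ
  v = 2 * (c * g)

  -- The cast reassociates: `GDD` has 2 * (c * g) points, while `remQuot` splits (2 * c) * g.
  decode : Fin v → Point
  decode z = remQuot g (cast (sym (*-assoc 2 c g)) z)

  encode : Point → Fin v
  encode (k , u) = cast (*-assoc 2 c g) (combine k u)

  decode-encode : ∀ X → decode (encode X) ≡ X
  decode-encode (k , u) = trans (cong (remQuot g) (cast-involutive (sym (*-assoc 2 c g)) (*-assoc 2 c g) (combine k u))) (remQuot-combine k u)

  encode-decode : ∀ z → encode (decode z) ≡ z
  encode-decode z = trans (cong (cast (*-assoc 2 c g)) (combine-remQuot {C} g (cast (sym (*-assoc 2 c g)) z))) (cast-involutive (*-assoc 2 c g) (sym (*-assoc 2 c g)) z)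

  δₚ-≟ : ∀ X Y → δₚ X Y ≡ 𝟙 (X ≟ₚ Y)
  δₚ-≟ (k , u) (l , w) = trans (sym (𝟙-× (k ≟ l) (u ≟ w)))
    (𝟙-⇔ (k ≟ l ×-dec u ≟ w) ((k , u) ≟ₚ (l , w)) (λ { (refl , refl) → refl }) (λ { refl → refl , refl }))

  δₚ-decode : ∀ X z → δₚ X (decode z) ≡ δ z (encode X)
  δₚ-decode X z = trans (δₚ-≟ X (decode z)) (𝟙-⇔ (X ≟ₚ decode z) (z ≟ encode X)
    (λ { refl → sym (encode-decode z) }) (λ { refl → sym (decode-encode X) }))

  -- Reindexing along a bijection: expand each term as a sum of `δₚ` over all points and exchange
  -- the summations.
  ∑-decode : ∀ (h : Point → ℕ) → ∑[ z ∈ allFin v ] h (decode z) ≡ ∑[ k ∈ allFin C ] ∑[ u ∈ allFin g ] h (k , u)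
  ∑-decode h = begin
    ∑[ z ∈ allFin v ] h (decode z)                                                       ≡⟨ ∑-cong (allFin v) (λ z → sym (expand (decode z))) ⟩
    ∑[ z ∈ allFin v ] ∑[ k ∈ allFin C ] ∑[ u ∈ allFin g ] (δₚ (k , u) (decode z) * h (k , u))
      ≡⟨ ∑-swap (allFin v) (allFin C) (λ z k → ∑[ u ∈ allFin g ] (δₚ (k , u) (decode z) * h (k , u))) ⟩
    ∑[ k ∈ allFin C ] ∑[ z ∈ allFin v ] ∑[ u ∈ allFin g ] (δₚ (k , u) (decode z) * h (k , u))
      ≡⟨ ∑-cong (allFin C) (λ k → ∑-swap (allFin v) (allFin g) λ z u → δₚ (k , u) (decode z) * h (k , u)) ⟩
    ∑[ k ∈ allFin C ] ∑[ u ∈ allFin g ] ∑[ z ∈ allFin v ] (δₚ (k , u) (decode z) * h (k , u))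
      ≡⟨ ∑-cong (allFin C) (λ k → ∑-cong (allFin g) λ u → trans (∑-cong (allFin v) λ z → cong (_* h (k , u)) (δₚ-decode (k , u) z)) (∑-δ (encode (k , u)) λ _ → h (k , u))) ⟩
    ∑[ k ∈ allFin C ] ∑[ u ∈ allFin g ] h (k , u)                                        ∎
    where
    expand : ∀ Y → ∑[ k ∈ allFin C ] ∑[ u ∈ allFin g ] (δₚ (k , u) Y * h (k , u)) ≡ h Y
    expand (l , w) = begin
      ∑[ k ∈ allFin C ] ∑[ u ∈ allFin g ] (δ k l * δ u w * h (k , u))     ≡⟨ ∑-cong (allFin C) (λ k → trans (∑-cong (allFin g) λ u → *-assoc (δ k l) (δ u w) (h (k , u))) (∑-*ˡ (δ k l) (allFin g) λ u → δ u w * h (k , u))) ⟩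
      ∑[ k ∈ allFin C ] (δ k l * ∑[ u ∈ allFin g ] (δ u w * h (k , u)))   ≡⟨ ∑-δ l (λ k → ∑[ u ∈ allFin g ] (δ u w * h (k , u))) ⟩
      ∑[ u ∈ allFin g ] (δ u w * h (l , u))                               ≡⟨ ∑-δ w (λ u → h (l , u)) ⟩
      h (l , w)                                                           ∎

  -- Under this condition the block, a set, loses nothing against the list of its points: its size
  -- is the length of the list, and membership equals multiplicity.
  Simple : Index → Set
  Simple i = AllPairs _≢_ (points i)

  ∑-δₚ-∈ : ∀ {Ys} → AllPairs _≢_ Ys → ∀ X → ∑[ Y ∈ Ys ] δₚ Y X ≡ 𝟙 (X ∈? Ys)
  ∑-δₚ-∈ [] X = refl
  ∑-δₚ-∈ {Y ∷ Ys} (Y∉Ys ∷ simple) X with Y ≟ₚ X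
  ... | yes refl = trans (cong₂ _+_ (trans (δₚ-≟ X X) (𝟙-yes (X ≟ₚ X) refl)) absent) (sym (𝟙-yes (X ∈? (Y ∷ Ys)) (here refl)))
    where
    absent : ∑[ Z ∈ Ys ] δₚ Z X ≡ 0
    absent = trans (∑-congᴬ (All.map (λ {Z} X≢Z → trans (δₚ-≟ Z X) (𝟙-no (Z ≟ₚ X) (X≢Z ∘ sym))) Y∉Ys))
      (trans (∑-const 0 Ys) (*-zeroʳ (length Ys)))
  ... | no Y≢X = trans (cong₂ _+_ (trans (δₚ-≟ Y X) (𝟙-no (Y ≟ₚ X) Y≢X)) (∑-δₚ-∈ simple X))
    (𝟙-⇔ (X ∈? Ys) (X ∈? (Y ∷ Ys)) there λ { (here X≡Y) → contradiction (sym X≡Y) Y≢X ; (there X∈Ys) → X∈Ys })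

  -- With h = 1 this gives the size of a block, and with h the indicator of a side its intersection
  -- with a group.
  ∑-members : ∀ {Ys} → AllPairs _≢_ Ys → ∀ (h : Point → ℕ) → ∑[ z ∈ allFin v ] (𝟙 (decode z ∈? Ys) * h (decode z)) ≡ ∑ Ys h
  ∑-members {Ys} simple h = begin
    ∑[ z ∈ allFin v ] (𝟙 (decode z ∈? Ys) * h (decode z))                    ≡⟨ ∑-cong (allFin v) (λ z → cong (_* h (decode z)) (∑-δₚ-∈ simple (decode z))) ⟨
    ∑[ z ∈ allFin v ] (∑[ Y ∈ Ys ] δₚ Y (decode z) * h (decode z))           ≡⟨ ∑-cong (allFin v) (λ z → ∑-*ʳ (h (decode z)) Ys λ Y → δₚ Y (decode z)) ⟨
    ∑[ z ∈ allFin v ] ∑[ Y ∈ Ys ] (δₚ Y (decode z) * h (decode z))           ≡⟨ ∑-swap (allFin v) Ys (λ z Y → δₚ Y (decode z) * h (decode z)) ⟩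
    ∑[ Y ∈ Ys ] ∑[ z ∈ allFin v ] (δₚ Y (decode z) * h (decode z))           ≡⟨ ∑-cong Ys (λ Y → trans (∑-cong (allFin v) λ z → cong (_* h (decode z)) (δₚ-decode Y z)) (trans (∑-δ (encode Y) (h ∘ decode)) (cong h (decode-encode Y)))) ⟩
    ∑ Ys h                                                                   ∎

  block : Index → Subset v
  block i = Vec.tabulate λ z → does (decode z ∈? points i)

  𝟙-block : ∀ {i} → Simple i → ∀ z → 𝟙 (z Subset.∈? block i) ≡ multiplicity i (decode z)
  𝟙-block {i} simple z = trans (𝟙-∈-tabulate (λ z → does (decode z ∈? points i)) z) (sym (∑-δₚ-∈ simple (decode z)))

  side : Point → Fin 2
  side (k , _) = toℕ k mod 2

  -- Agrees by computation with `GDD.group` of the design `gdd`, so that the sizes found here serve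
  -- there unchanged.
  group : Fin 2 → Subset v
  group j = Vec.tabulate λ z → does (side (decode z) ≟ j)

  ∣block∣ : ∀ {i} → Simple i → ∣ block i ∣ ≡ length (points i)
  ∣block∣ {i} simple = begin
    ∣ block i ∣                                         ≡⟨ ∣tabulate∣ (λ z → does (decode z ∈? points i)) ⟩
    ∑[ z ∈ allFin v ] 𝟙 (decode z ∈? points i)          ≡⟨ ∑-cong (allFin v) (λ z → *-identityʳ (𝟙 (decode z ∈? points i))) ⟨
    ∑[ z ∈ allFin v ] (𝟙 (decode z ∈? points i) * 1)    ≡⟨ ∑-members simple (λ _ → 1) ⟩
    ∑[ _ ∈ points i ] 1                                 ≡⟨ trans (∑-const 1 (points i)) (*-identityʳ _) ⟩
    length (points i)                                   ∎

  ∣block∩group∣ : ∀ {i} → Simple i → ∀ j → ∣ block i ∩ group j ∣ ≡ ∑[ Y ∈ points i ] δ (side Y) j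
  ∣block∩group∣ {i} simple j = trans (∣tabulate-∩∣ (λ z → does (decode z ∈? points i)) (λ z → does (side (decode z) ≟ j)))
    (∑-members simple λ Y → δ (side Y) j)

  ∣group∣ : ∀ j → ∣ group j ∣ ≡ c * g
  ∣group∣ j = begin
    ∣ group j ∣                                                     ≡⟨ ∣tabulate∣ (λ z → does (side (decode z) ≟ j)) ⟩
    ∑[ z ∈ allFin v ] δ (side (decode z)) j                         ≡⟨ ∑-decode (λ X → δ (side X) j) ⟩
    ∑[ k ∈ allFin C ] ∑[ _ ∈ allFin g ] δ (toℕ k mod 2) j           ≡⟨ ∑-cong (allFin C) (λ k → trans (∑-allFin-const (δ (toℕ k mod 2) j) g) (*-comm g _)) ⟩
    ∑[ k ∈ allFin C ] (δ (toℕ k mod 2) j * g)                       ≡⟨ ∑-*ʳ g (allFin C) (λ k → δ (toℕ k mod 2) j) ⟩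
    ∑[ k ∈ allFin C ] δ (toℕ k mod 2) j * g                         ≡⟨ cong (_* g) (halves j) ⟩
    c * g                                                           ∎

  -- C is even, so parity is well defined on Z_C.
  %C%2 : ∀ a → a % C % 2 ≡ a % 2
  %C%2 a = m∣n⇒o%n%m≡o%m 2 C a (m∣m*n c)

  ≈⇒≈₂ : ∀ {a b} → a ≈ b → a Mod₂.≈ b
  ≈⇒≈₂ {a} {b} p = Mod₂.residues (trans (sym (%C%2 a)) (trans (cong (_% 2) (residue-≡ p)) (%C%2 b)))

  ∑-side : ∀ P s j → ∑[ Y ∈ points (P , s) ] δ (side Y) j ≡ census P j (toℕ (toℕ (proj₁ s) mod 2))
  ∑-side P (e , t) j = trans (∑-map (point (e , t)) P λ Y → δ (side Y) j)
    (∑-cong P λ (p , a) → cong (λ i → δ i j) (Mod₂.mod-≈ (Mod₂.≈-trans (≈⇒≈₂ (toℕ-mod (a + toℕ e)))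
      (Mod₂.+-≈ {a} Mod₂.≈-refl (Mod₂.≈-sym (Mod₂.toℕ-mod (toℕ e)))))))

  ⊕-distinct : ∀ {a b} e → a % C ≢ b % C → a ⊕ e ≢ b ⊕ e
  ⊕-distinct {a} {b} e a≢b p = a≢b (residue-≡ (+-cancelˡ-≈ (toℕ e)
    (≈-trans (≈-reflexive (+-comm (toℕ e) a)) (≈-trans (mod-≈⁻¹ p) (≈-reflexive (+-comm b (toℕ e)))))))

  -- Different colours stay different under translation; entries of one class have different values
  -- because x ≠ y.
  generic-simple : All Simple (indices offDiagonal generic)
  generic-simple = All.cartesianProduct⁺ (setoid _) (setoid _) generic _ λ {P} {s} P∈ s∈ →
    simple P s (All.lookup generic-distinct P∈) (All.lookup off s∈)
    where
    Off : Fin C × ((K × K) × K) → Set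
    Off (e , ((x , y) , v)) = x ≢ y
    off : All Off (cartesianProduct (allFin C) (params offDiagonal))
    off = All.cartesianProduct⁺ (setoid _) (setoid _) (allFin C) _ λ _ t∈ → All.lookup
      (All.cartesianProduct⁺ (setoid _) (setoid _) offDiagonal (allFin g) λ w∈ _ → All.lookup (All.all-filter (¬? ∘ uncurry _≟_) square) w∈) t∈
    simple : ∀ P s → AllPairs (λ (p , a) (q , b) → a % C ≢ b % C ⊎ mate p q ≡ 1 × same p q ≡ 0) P → Off s → Simple (P , s)
    simple P s@(e , t) distinct x≢y = AllPairs.map⁺ (AllPairs.map
      (λ { {p , a} {q , b} (inj₁ a≢b) eq → ⊕-distinct {a} {b} e a≢b (cong proj₁ eq)
         ; {p , a} {q , b} (inj₂ (m , s)) eq → column-separates p q m s x≢y (cong proj₂ eq) }) distinct)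

  degenerate-simple : All Simple (indices diagonal degenerate)
  degenerate-simple = All.cartesianProduct⁺ (setoid _) (setoid _) degenerate _ λ {P} {s} P∈ _ →
    AllPairs.map⁺ (AllPairs.map (λ { {p , a} {q , b} a≢b eq → ⊕-distinct {a} {b} (proj₁ s) a≢b (cong proj₁ eq) }) (All.lookup degenerate-distinct P∈))

  allIndices : List Index
  allIndices = indices offDiagonal generic ++ indices diagonal degenerate

  all-simple : All Simple allIndices
  all-simple = All.++⁺ generic-simple degenerate-simple

  all-patterns : ∀ {R : Pattern → Set} → All R generic → All R degenerate → All (R ∘ proj₁) allIndices
  all-patterns rg rd = All.++⁺
    (All.cartesianProduct⁺ (setoid _) (setoid _) generic _ λ P∈ _ → All.lookup rg P∈)
    (All.cartesianProduct⁺ (setoid _) (setoid _) degenerate _ λ P∈ _ → All.lookup rd P∈)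

  blocks : List (Subset v)
  blocks = map block allIndices

  replication-≡ : ∀ z → replication blocks z ≡ ∑[ i ∈ allIndices ] multiplicity i (decode z)
  replication-≡ z = begin
    replication blocks z                              ≡⟨ length-filter≡∑ (λ B → z Subset.∈? B) blocks ⟩
    ∑[ B ∈ blocks ] 𝟙 (z Subset.∈? B)                 ≡⟨ ∑-map block allIndices (λ B → 𝟙 (z Subset.∈? B)) ⟩
    ∑[ i ∈ allIndices ] 𝟙 (z Subset.∈? block i)       ≡⟨ ∑-congᴬ (All.map (λ simple → 𝟙-block simple z) all-simple) ⟩
    ∑[ i ∈ allIndices ] multiplicity i (decode z)     ∎

  index-≡ : ∀ y z → index blocks y z ≡ ∑[ i ∈ allIndices ] (multiplicity i (decode y) * multiplicity i (decode z))
  index-≡ y z = begin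
    index blocks y z                                                                       ≡⟨ length-filter≡∑ (λ B → y Subset.∈? B ×-dec z Subset.∈? B) blocks ⟩
    ∑[ B ∈ blocks ] 𝟙 (y Subset.∈? B ×-dec z Subset.∈? B)                                  ≡⟨ ∑-map block allIndices (λ B → 𝟙 (y Subset.∈? B ×-dec z Subset.∈? B)) ⟩
    ∑[ i ∈ allIndices ] 𝟙 (y Subset.∈? block i ×-dec z Subset.∈? block i)                  ≡⟨ ∑-congᴬ (All.map (λ {i} simple → trans (𝟙-× (y Subset.∈? block i) (z Subset.∈? block i)) (cong₂ _*_ (𝟙-block simple y) (𝟙-block simple z))) all-simple) ⟩
    ∑[ i ∈ allIndices ] (multiplicity i (decode y) * multiplicity i (decode z))            ∎

  -- The subtraction is exact: it removes the diagonal of the generic patterns.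
  r : ℕ
  r = (length generic * (6 * (g * g)) ∸ length generic * (6 * (g * 1))) + length degenerate * (6 * (g * 1))

  replication-constant : ∀ z → replication blocks z ≡ r
  replication-constant z = trans (replication-≡ z) (trans (∑-++ (indices offDiagonal generic) _ _)
    (cong₂ _+_ off (replications diagonal degenerate Diagonal.occurrences-≡ degenerate-size X)))
    where
    X = decode z
    off : ∑[ i ∈ indices offDiagonal generic ] multiplicity i X ≡ length generic * (6 * (g * g)) ∸ length generic * (6 * (g * 1))
    off = begin
      F offDiagonal                                      ≡⟨ m+n∸n≡m (F offDiagonal) (F diagonal) ⟨
      (F offDiagonal + F diagonal) ∸ F diagonal          ≡⟨ cong₂ _∸_ (trans (∑-offDiagonal generic _) (replications square generic Square.occurrences-≡ generic-size X)) (replications diagonal generic Diagonal.occurrences-≡ generic-size X) ⟩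
      length generic * (6 * (g * g)) ∸ length generic * (6 * (g * 1)) ∎
      where
      F : List (K × K) → ℕ
      F W = ∑[ i ∈ indices W generic ] multiplicity i X

  gap≡0 : ∀ k l → toℕ (gap k l) ≡ 0 → k ≡ l
  gap≡0 k l p = toℕ-≈-injective (≈-trans (≈-reflexive (sym (trans (cong (toℕ k +_) p) (+-identityʳ (toℕ k))))) (+-gap k l))

  parity : Point → Point → ℕ
  parity (k , _) (l , _) = toℕ (gap k l) % 2

  -- On two distinct points, the diagonal of the generic patterns exceeds the degenerate blocks by
  -- the parity of the colour difference. Adding that parity therefore restores the full square,
  -- whose count is known, without any subtraction.
  coincidences-sum : ∀ X Y → X ≢ Y →
    ∑[ i ∈ allIndices ] (multiplicity i X * multiplicity i Y) + parity X Y ≡ g * (c * (2 ∸ parity X Y))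
  coincidences-sum X@(k , u) Y@(l , w) X≢Y = begin
    ∑ allIndices f + s                                                                 ≡⟨ cong (_+ s) (∑-++ (indices offDiagonal generic) _ f) ⟩
    coincidences offDiagonal generic X Y + coincidences diagonal degenerate X Y + s    ≡⟨ +-assoc (coincidences offDiagonal generic X Y) _ s ⟩
    coincidences offDiagonal generic X Y + (coincidences diagonal degenerate X Y + s)  ≡⟨ cong (coincidences offDiagonal generic X Y +_) diagonals ⟨
    coincidences offDiagonal generic X Y + coincidences diagonal generic X Y           ≡⟨ ∑-offDiagonal generic f ⟩
    coincidences square generic X Y                                                    ≡⟨ square-coincidences generic k l u w ⟩
    g * tally apart generic d + g * g * δ u w * tally same generic d                   ≡⟨ cong₂ _+_ (cong (g *_) (apart-tally D)) same-vanishes ⟩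
    g * (c * (2 ∸ s)) + 0                                                              ≡⟨ +-identityʳ _ ⟩
    g * (c * (2 ∸ s))                                                                  ∎
    where
    D = gap k l
    d = toℕ D
    s = d % 2
    f : Index → ℕ
    f i = multiplicity i X * multiplicity i Y
    -- Distinct points of equal colour have distinct values; this settles d = 0, which `same-tally`
    -- and `mate-tally` leave out.
    δ≡0 : d ≡ 0 → δ u w ≡ 0
    δ≡0 d≡0 = 𝟙-no (u ≟ w) λ u≡w → X≢Y (cong₂ _,_ (gap≡0 k l d≡0) u≡w)
    same-vanishes : g * g * δ u w * tally same generic d ≡ 0
    same-vanishes with d ≟ℕ 0
    ... | yes d≡0 = cong (_* tally same generic d) (trans (cong (g * g *_) (δ≡0 d≡0)) (*-zeroʳ (g * g)))
    ... | no d≢0  = trans (cong (g * g * δ u w *_) (same-tally D d≢0)) (*-zeroʳ (g * g * δ u w))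
    mates : g * δ u w * tally mate generic d ≡ g * δ u w * tally mate degenerate d
    mates with d ≟ℕ 0
    ... | yes d≡0 = trans (cong (_* tally mate generic d) gδ≡0) (sym (cong (_* tally mate degenerate d) gδ≡0))
      where
      gδ≡0 : g * δ u w ≡ 0
      gδ≡0 = trans (cong (g *_) (δ≡0 d≡0)) (*-zeroʳ g)
    ... | no d≢0  = cong (g * δ u w *_) (mate-tally D d≢0)
    diagonals : coincidences diagonal generic X Y ≡ coincidences diagonal degenerate X Y + s
    diagonals = begin
      coincidences diagonal generic X Y                                                     ≡⟨ diagonal-coincidences generic k l u w ⟩
      1 * tally cross generic d + g * δ u w * tally mate generic d                          ≡⟨ cong₂ _+_ (cong (1 *_) (cross-tally D)) mates ⟩
      1 * (tally cross degenerate d + s) + g * δ u w * tally mate degenerate d              ≡⟨ shuffle (tally cross degenerate d) s (g * δ u w * tally mate degenerate d) ⟩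
      1 * tally cross degenerate d + g * δ u w * tally mate degenerate d + s                ≡⟨ cong (_+ s) (diagonal-coincidences degenerate k l u w) ⟨
      coincidences diagonal degenerate X Y + s                                              ∎
      where
      shuffle : ∀ a s b → 1 * (a + s) + b ≡ 1 * a + b + s
      shuffle = solve 3 (λ a s b → con 1 :* (a :+ s) :+ b := con 1 :* a :+ b :+ s) refl
        where open +-*-Solver

  sides-differ-by : ∀ k l → toℕ k + toℕ (gap k l) Mod₂.≈ toℕ l
  sides-differ-by k l = ≈⇒≈₂ (+-gap k l)

  same-parity : ∀ X Y → side X ≡ side Y → parity X Y ≡ 0
  same-parity (k , _) (l , _) p = Mod₂.residue-≡ (Mod₂.+-cancelˡ-≈ (toℕ k)
    (Mod₂.≈-trans (sides-differ-by k l) (Mod₂.≈-trans (Mod₂.≈-sym (Mod₂.mod-≈⁻¹ p)) (Mod₂.≈-reflexive (sym (+-identityʳ (toℕ k)))))))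

  different-parity : ∀ X Y → side X ≢ side Y → parity X Y ≡ 1
  different-parity (k , _) (l , _) k≢l with toℕ (gap k l) % 2 in eq | m%n<n (toℕ (gap k l)) 2
  ... | 0           | _               = contradiction (Mod₂.mod-≈ (Mod₂.≈-trans (Mod₂.≈-reflexive (sym (+-identityʳ (toℕ k))))
    (Mod₂.≈-trans (Mod₂.+-≈ {toℕ k} Mod₂.≈-refl (Mod₂.residues (sym eq))) (sides-differ-by k l)))) k≢l
  ... | 1           | _               = refl
  ... | suc (suc _) | s≤s (s≤s ())

  index-sum : ∀ y z → y ≢ z → index blocks y z + parity (decode y) (decode z) ≡ g * (c * (2 ∸ parity (decode y) (decode z)))
  index-sum y z y≢z = trans (cong (_+ parity (decode y) (decode z)) (index-≡ y z)) (coincidences-sum (decode y) (decode z)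
    λ p → y≢z (trans (sym (encode-decode y)) (trans (cong encode p) (encode-decode z))))

  gdd : GDD (c * g) 2 6 (2 * (c * g)) (c * g ∸ 1)
  gdd = record
    { groupOf   = side ∘ decode
    ; blocks    = blocks
    ; groupSize = ∣group∣
    ; blockSize = All.map⁺ (All.zipWith (λ { {P , s} (simple , size) → trans (∣block∣ simple) (trans (length-map (point s) P) size) })
                    (all-simple , all-patterns generic-size degenerate-size))
    ; r         = r
    ; regular   = replication-constant
    ; sameGroup = sameGroup
    ; diffGroup = diffGroup
    }
    where
    even-gap : ∀ {m s} → s ≡ 0 → m + s ≡ g * (c * (2 ∸ s)) → m ≡ 2 * (c * g)
    even-gap {m} refl eq = trans (sym (+-identityʳ m)) (trans eq (solve 2 (λ g c → g :* (c :* con 2) := con 2 :* (c :* g)) refl g c))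
      where open +-*-Solver
    -- The hypothesis reads m + 1 = g c, so the truncated subtraction of 1 is exact.
    odd-gap : ∀ {m s} → s ≡ 1 → m + s ≡ g * (c * (2 ∸ s)) → m ≡ c * g ∸ 1
    odd-gap {m} refl eq = trans (sym (m+n∸n≡m m 1)) (cong (_∸ 1) (trans eq (trans (cong (g *_) (*-identityʳ c)) (*-comm g c))))
    sameGroup : ∀ y z → y ≢ z → side (decode y) ≡ side (decode z) → index blocks y z ≡ 2 * (c * g)
    sameGroup y z y≢z p = even-gap (same-parity (decode y) (decode z) p) (index-sum y z y≢z)
    diffGroup : ∀ y z → side (decode y) ≢ side (decode z) → index blocks y z ≡ c * g ∸ 1
    diffGroup y z p = odd-gap (different-parity (decode y) (decode z) p) (index-sum y z (p ∘ cong (side ∘ decode)))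

  configuration : HasConfiguration 1 5 gdd
  configuration = All.map⁺ (All.zipWith (λ { {P , s} (simple , ones) → split simple ones })
    (all-simple , all-patterns generic-split degenerate-split))
    where
    size : ∀ {P s} → Simple (P , s) → ∀ j → census P j (toℕ (toℕ (proj₁ s) mod 2)) ≡ ∣ block (P , s) ∩ group j ∣
    size {P} {s} simple j = sym (trans (∣block∩group∣ simple j) (∑-side P s j))
    split : ∀ {P s} → Simple (P , s) → (∀ (e : Fin 2) → OneFive (census P zero (toℕ e)) (census P (suc zero) (toℕ e))) →
      OneFive ∣ block (P , s) ∩ group zero ∣ ∣ block (P , s) ∩ group (suc zero) ∣
    split {P} {s} simple ones = subst₂ OneFive (size simple zero) (size simple (suc zero)) (ones (toℕ (proj₁ s) mod 2))

-- Two systems of patterns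

-- The subscripts count inner, outer and apex positions. A pattern is written as a row of colours
-- zipped with one of these layouts.
layout₃₃ layout₃₂₁ : List Position
layout₃₃  = map inner (allFin 3) ++ map outer (allFin 3)
layout₃₂₁ = map inner (allFin 3) ++ outer (# 0) ∷ outer (# 1) ∷ apex ∷ []

oneFive? : ∀ m n → Dec (OneFive m n)
oneFive? m n = (m ≟ℕ 1 ×-dec n ≟ℕ 5) ⊎-dec (m ≟ℕ 5 ×-dec n ≟ℕ 1)

split? : (P : Pattern) → Dec (∀ (e : Fin 2) → OneFive (census P zero (toℕ e)) (census P (suc zero) (toℕ e)))
split? P = all? λ e → oneFive? (census P zero (toℕ e)) (census P (suc zero) (toℕ e))

-- All conditions are finite and settled by evaluation. Each row has exactly one odd colour, so
-- every translate splits as 1 and 5. Repeated colours occur only in generic rows and within one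
-- class.
design10 : Design 10
design10 = record
  { generic             = generic
  ; degenerate          = degenerate
  ; generic-distinct    = from-yes (All.all? (allPairs? λ { (p , a) (q , b) → ¬? (a % 20 ≟ℕ b % 20) ⊎-dec mate p q ≟ℕ 1 ×-dec same p q ≟ℕ 0 }) generic)
  ; degenerate-distinct = from-yes (All.all? (allPairs? λ { (p , a) (q , b) → ¬? (a % 20 ≟ℕ b % 20) }) degenerate)
  ; generic-size        = from-yes (All.all? (λ P → length P ≟ℕ 6) generic)
  ; degenerate-size     = from-yes (All.all? (λ P → length P ≟ℕ 6) degenerate)
  ; generic-split       = from-yes (All.all? split? generic)
  ; degenerate-split    = from-yes (All.all? split? degenerate)
  ; halves              = from-yes (all? λ i → ∑[ k ∈ allFin 20 ] δ (toℕ k mod 2) i ≟ℕ 10)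
  ; apart-tally         = from-yes (all? λ (d : Fin 20) → tally apart generic (toℕ d) ≟ℕ 10 * (2 ∸ toℕ d % 2))
  ; same-tally          = from-yes (all? λ (d : Fin 20) → ¬? (toℕ d ≟ℕ 0) →-dec tally same generic (toℕ d) ≟ℕ 0)
  ; cross-tally         = from-yes (all? λ (d : Fin 20) → tally cross generic (toℕ d) ≟ℕ tally cross degenerate (toℕ d) + toℕ d % 2)
  ; mate-tally          = from-yes (all? λ (d : Fin 20) → ¬? (toℕ d ≟ℕ 0) →-dec tally mate generic (toℕ d) ≟ℕ tally mate degenerate (toℕ d))
  }
  where
  open Colours 20
  -- These patterns are in both lists, so in effect they are used with all (x , y , v).
  transversal generic degenerate : List Pattern
  transversal = map (zip layout₃₂₁)
    ( ( 2 ∷ 14 ∷ 18 ∷  0 ∷  6 ∷ 13 ∷ [])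
    ∷ ( 4 ∷  8 ∷  6 ∷  2 ∷  0 ∷  5 ∷ [])
    ∷ ( 8 ∷ 12 ∷ 18 ∷  4 ∷ 10 ∷  1 ∷ [])
    ∷ ( 8 ∷ 14 ∷ 12 ∷  0 ∷  4 ∷  3 ∷ [])
    ∷ ( 2 ∷ 12 ∷ 18 ∷  0 ∷  6 ∷ 17 ∷ [])
    ∷ ( 4 ∷ 18 ∷ 16 ∷ 10 ∷ 14 ∷ 11 ∷ []) ∷ [] )
  -- Ten patterns with 30 ordered pairs of entries each supply the 10 · 20 + 10 · 10 differences
  -- that `apart-tally` requires.
  generic = map (zip layout₃₃)
    ( (12 ∷ 12 ∷ 12 ∷  2 ∷  2 ∷  1 ∷ [])
    ∷ ( 6 ∷  6 ∷  6 ∷  4 ∷  4 ∷  1 ∷ [])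
    ∷ (16 ∷ 16 ∷ 10 ∷  2 ∷  4 ∷  9 ∷ []) ∷ [] )
    ++ map (zip layout₃₂₁)
    ( (18 ∷ 18 ∷  2 ∷  6 ∷ 14 ∷  5 ∷ []) ∷ [] )
    ++ transversal
  -- These three rows have 18 odd differences across classes, against 28 for the four generic rows
  -- outside `transversal`: one fewer for each of the ten odd d.
  degenerate = map (zip layout₃₂₁)
    ( ( 4 ∷ 18 ∷  5 ∷  6 ∷ 14 ∷ 16 ∷ [])
    ∷ ( 0 ∷ 18 ∷  3 ∷ 10 ∷ 16 ∷  8 ∷ [])
    ∷ (12 ∷ 16 ∷ 15 ∷  6 ∷ 10 ∷  2 ∷ []) ∷ [] )
    ++ transversal

design20 : Design 20
design20 = record
  { generic             = generic
  ; degenerate          = degenerate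
  ; generic-distinct    = from-yes (All.all? (allPairs? λ { (p , a) (q , b) → ¬? (a % 40 ≟ℕ b % 40) ⊎-dec mate p q ≟ℕ 1 ×-dec same p q ≟ℕ 0 }) generic)
  ; degenerate-distinct = from-yes (All.all? (allPairs? λ { (p , a) (q , b) → ¬? (a % 40 ≟ℕ b % 40) }) degenerate)
  ; generic-size        = from-yes (All.all? (λ P → length P ≟ℕ 6) generic)
  ; degenerate-size     = from-yes (All.all? (λ P → length P ≟ℕ 6) degenerate)
  ; generic-split       = from-yes (All.all? split? generic)
  ; degenerate-split    = from-yes (All.all? split? degenerate)
  ; halves              = from-yes (all? λ i → ∑[ k ∈ allFin 40 ] δ (toℕ k mod 2) i ≟ℕ 20)
  ; apart-tally         = from-yes (all? λ (d : Fin 40) → tally apart generic (toℕ d) ≟ℕ 20 * (2 ∸ toℕ d % 2))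
  ; same-tally          = from-yes (all? λ (d : Fin 40) → ¬? (toℕ d ≟ℕ 0) →-dec tally same generic (toℕ d) ≟ℕ 0)
  ; cross-tally         = from-yes (all? λ (d : Fin 40) → tally cross generic (toℕ d) ≟ℕ tally cross degenerate (toℕ d) + toℕ d % 2)
  ; mate-tally          = from-yes (all? λ (d : Fin 40) → ¬? (toℕ d ≟ℕ 0) →-dec tally mate generic (toℕ d) ≟ℕ tally mate degenerate (toℕ d))
  }
  where
  open Colours 40
  transversal generic degenerate : List Pattern
  transversal = map (zip layout₃₂₁)
    ( (24 ∷ 20 ∷ 22 ∷ 28 ∷  6 ∷ 15 ∷ [])
    ∷ (22 ∷ 24 ∷ 36 ∷ 12 ∷ 16 ∷ 25 ∷ [])
    ∷ (18 ∷ 38 ∷  4 ∷ 26 ∷ 30 ∷  5 ∷ [])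
    ∷ (22 ∷ 20 ∷ 32 ∷ 26 ∷  0 ∷ 35 ∷ [])
    ∷ (34 ∷ 18 ∷  4 ∷ 32 ∷ 26 ∷ 27 ∷ [])
    ∷ (12 ∷  8 ∷ 16 ∷  6 ∷ 28 ∷ 35 ∷ [])
    ∷ ( 8 ∷  6 ∷ 12 ∷ 30 ∷ 18 ∷ 11 ∷ [])
    ∷ (32 ∷ 34 ∷ 10 ∷ 22 ∷ 12 ∷  1 ∷ [])
    ∷ ( 8 ∷ 18 ∷ 38 ∷ 22 ∷ 24 ∷ 13 ∷ [])
    ∷ ( 0 ∷ 38 ∷ 20 ∷ 22 ∷ 10 ∷ 27 ∷ [])
    ∷ ( 4 ∷ 32 ∷ 24 ∷  8 ∷  2 ∷ 23 ∷ [])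
    ∷ (18 ∷  0 ∷ 10 ∷ 34 ∷ 32 ∷ 39 ∷ [])
    ∷ (14 ∷  4 ∷  6 ∷ 16 ∷ 26 ∷  1 ∷ [])
    ∷ (10 ∷ 34 ∷ 38 ∷ 24 ∷ 22 ∷ 35 ∷ [])
    ∷ (18 ∷ 22 ∷ 12 ∷ 10 ∷  6 ∷ 19 ∷ [])
    ∷ (32 ∷  6 ∷ 18 ∷ 24 ∷ 28 ∷ 17 ∷ [])
    ∷ (18 ∷ 10 ∷ 36 ∷ 26 ∷ 20 ∷ 23 ∷ [])
    ∷ (26 ∷ 16 ∷  6 ∷ 24 ∷ 18 ∷ 33 ∷ [])
    ∷ (38 ∷  8 ∷ 34 ∷ 26 ∷ 30 ∷ 27 ∷ [])
    ∷ (30 ∷ 34 ∷  4 ∷ 20 ∷ 16 ∷ 33 ∷ [])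
    ∷ (24 ∷ 22 ∷ 28 ∷ 20 ∷ 18 ∷ 35 ∷ [])
    ∷ (30 ∷ 10 ∷ 36 ∷ 12 ∷ 14 ∷ 13 ∷ [])
    ∷ (22 ∷  2 ∷ 18 ∷ 28 ∷ 34 ∷ 19 ∷ [])
    ∷ (26 ∷  2 ∷ 38 ∷  6 ∷  8 ∷ 17 ∷ [])
    ∷ ( 4 ∷ 24 ∷ 32 ∷ 18 ∷  0 ∷ 39 ∷ [])
    ∷ (36 ∷ 22 ∷ 12 ∷ 16 ∷ 28 ∷ 39 ∷ [])
    ∷ (36 ∷ 14 ∷ 38 ∷  0 ∷  4 ∷ 19 ∷ [])
    ∷ ( 0 ∷ 18 ∷ 10 ∷ 34 ∷ 28 ∷  1 ∷ [])
    ∷ ( 2 ∷ 38 ∷ 10 ∷ 36 ∷ 12 ∷ 17 ∷ [])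
    ∷ ( 8 ∷ 20 ∷ 32 ∷ 12 ∷ 22 ∷ 11 ∷ [])
    ∷ (38 ∷  6 ∷ 12 ∷ 28 ∷  4 ∷  1 ∷ [])
    ∷ ( 8 ∷  2 ∷ 20 ∷ 22 ∷ 18 ∷ 25 ∷ []) ∷ [] )
  -- Forty patterns, as 30 · 40 = 20 · 40 + 20 · 20.
  generic = map (zip layout₃₃)
    ( (34 ∷ 34 ∷ 34 ∷ 28 ∷ 28 ∷ 13 ∷ [])
    ∷ ( 4 ∷  4 ∷  4 ∷ 30 ∷ 30 ∷  9 ∷ [])
    ∷ (28 ∷ 28 ∷ 10 ∷  0 ∷  8 ∷ 11 ∷ [])
    ∷ (22 ∷ 22 ∷ 22 ∷ 14 ∷ 14 ∷  5 ∷ [])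
    ∷ (20 ∷ 20 ∷ 20 ∷  2 ∷  2 ∷ 35 ∷ [])
    ∷ (12 ∷ 12 ∷ 26 ∷ 10 ∷ 16 ∷ 21 ∷ []) ∷ [] )
    ++ map (zip layout₃₂₁)
    ( (22 ∷ 22 ∷ 34 ∷  6 ∷ 20 ∷ 33 ∷ [])
    ∷ ( 2 ∷  2 ∷ 18 ∷ 38 ∷  6 ∷  5 ∷ []) ∷ [] )
    ++ transversal
  degenerate = map (zip layout₃₂₁)
    ( (26 ∷ 20 ∷ 11 ∷  2 ∷ 28 ∷ 34 ∷ [])
    ∷ (18 ∷ 32 ∷ 37 ∷ 14 ∷ 38 ∷ 10 ∷ [])
    ∷ (34 ∷ 12 ∷ 27 ∷ 38 ∷ 10 ∷  6 ∷ [])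
    ∷ ( 2 ∷ 24 ∷ 35 ∷ 20 ∷ 36 ∷ 22 ∷ [])
    ∷ ( 2 ∷ 34 ∷ 13 ∷ 16 ∷  8 ∷ 28 ∷ [])
    ∷ (22 ∷ 34 ∷ 31 ∷ 12 ∷ 26 ∷ 36 ∷ []) ∷ [] )
    ++ transversal

-- Orders of idempotent quasigroups, and the theorem.

halve : ∀ m → ∃ λ k → m ≡ k + k ⊎ m ≡ suc (k + k)
halve zero    = 0 , inj₁ refl
halve (suc m) with halve m
... | k , inj₁ refl = k , inj₂ refl
... | k , inj₂ refl = suc k , inj₁ (cong suc (sym (+-suc k k)))

-- Midpoints give the odd orders 2k + 1, and for k ≥ 1 their prolongations give the even orders 2k +
-- 2.
idempotentQuasigroup : ∀ m → m ≢ 2 → IdempotentQuasigroup m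
idempotentQuasigroup zero    _   = record { _∙_ = λ () ; idem = λ () ; cancelˡ = λ () ; cancelʳ = λ () }
idempotentQuasigroup (suc m) m≢2 with halve m
... | k     , inj₁ refl = Midpoint.midpoint k
... | zero  , inj₂ refl = contradiction refl m≢2
... | suc k , inj₂ refl = Prolongation.prolongation midpoint next prev prev-next next-prev next≢ mid-next-injective
  where open Midpoint (suc k)

theorem7p3 : ∀ (n : ℕ) → 0 < n → n % 10 ≡ 0 → n ≢ 10 → n ≢ 160 → n ≢ 190 →
    Σ (GDD n 2 6 (2 * n) (n ∸ 1)) (λ D → HasConfiguration 1 5 D)
theorem7p3 n _ n%10≡0 _ _ _ = subst (λ n → Σ (GDD n 2 6 (2 * n) (n ∸ 1)) (λ D → HasConfiguration 1 5 D)) (sym n≡10*m) (construct m)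
  where
  m = n / 10
  n≡10*m : n ≡ 10 * m
  n≡10*m = trans (m≡m%n+[m/n]*n n 10) (trans (cong (_+ m * 10) n%10≡0) (*-comm m 10))
  construct : ∀ m → Σ (GDD (10 * m) 2 6 (2 * (10 * m)) (10 * m ∸ 1)) (λ D → HasConfiguration 1 5 D)
  construct m with m ≟ℕ 2
  -- `Midpoint.midpoint 0` has one element, so every triple is diagonal and all blocks come from the
  -- degenerate patterns.
  ... | yes refl = gdd , configuration
    where open Construction design20 (Midpoint.midpoint 0)
  ... | no m≢2   = gdd , configuration
    where open Construction design10 (idempotentQuasigroup m m≢2)
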